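{- Let $p,q$ be coprime positive integers. For $|z|<1$, the generating function $G_{p,q}(z)=\sum_{m\ge0}S_m(p,q)\,z^m$ admits the closed form $$G_{p,q}(z)=\frac{pq}{1-z^{pq}}-\frac{p}{1-z^p}-\frac{q}{1-z^q}+\frac{1}{1-z},$$ and it extends meromorphically to $\mathbb{C}$, its singularities being simple poles located at roots of unity $\xi$ with $\xi^r=1$ for some $r\in\{1,p,q,pq\}$. For a root of unity $\xi$ with $\xi^r=1$ for some $r\in\{1,p,q,pq\}$, $$\operatorname{Res}_{z=\xi}G_{p,q}(z)=-\mathbf{1}_{\xi^{pq}=1}\,\xi^{ -(pq-1)}+\mathbf{1}_{\xi^{p}=1}\,\xi^{ -(p-1)}+\mathbf{1}_{\xi^{q}=1}\,\xi^{ -(q-1)}-\mathbf{1}_{\xi=1}.$$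
   Context: For coprime positive integers $p,q$, $\Delta_{p,q}(t)=\frac{(t^{pq}-1)(t-1)}{(t^p-1)(t^q-1)}$ is the Alexander polynomial of the torus knot $T_{p,q}$; its zero set is $\mathcal{Z}_{p,q}=\{\zeta\in\mathbb{C}:\zeta^{pq}=1,\ \zeta^p\ne1,\ \zeta^q\neq1\}$ (all zeros simple). For $m\ge0$ the $m$-th moment is $S_m(p,q)=\sum_{\alpha}\alpha^m$, the sum over all zeros $\alpha$ of $\Delta_{p,q}$ counted with multiplicity. $\mathbf{1}_P$ denotes $1$ if $P$ holds and $0$ otherwise. -}

module Defs where

open import Algebra.Bundles using (CommutativeRing; RawRing)
import Algebra.Definitions.RawMonoid as RawMonoidDefs
import Algebra.Definitions.RawSemiring as RawSemiringDefs
open import Data.Bool.Base using (if_then_else_)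
open import Data.Fin.Base as Fin using (toℕ)
open import Data.List.Base using (List; []; _∷_; foldr)
open import Data.List.Relation.Unary.Any using (Any)
open import Data.Nat.Base as ℕ using (ℕ; suc)
open import Data.Product.Base using (Σ; ∃-syntax; _×_; _,_)
open import Data.Vec.Functional using (Vector)
open import Function.Bundles using (_⟶ₛ_; _⟨$⟩_)
open import Level using (_⊔_) renaming (suc to lsuc)
open import Relation.Binary.Bundles using (Setoid)
open import Relation.Binary.Core using (Rel)
open import Relation.Binary.Definitions using (Decidable)
open import Relation.Binary.Structures using (IsStrictTotalOrder)
open import Relation.Nullary using (¬_; Dec; does)
open import Relation.Nullary.Decidable using (map′; _×-dec_)

-- The real numbers, given by the axioms that determine them up to isomorphism:
-- an Archimedean, Cauchy-complete, totally ordered field.  The order is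
-- trichotomous in the strong (decidable) sense, i.e. these are the classical
-- reals.
record CompleteOrderedField c ℓ₁ ℓ₂ : Set (lsuc (c ⊔ ℓ₁ ⊔ ℓ₂)) where
  infix 8 _⁻¹
  infix 4 _<_
  field
    commutativeRing : CommutativeRing c ℓ₁

  open CommutativeRing commutativeRing public

  -- _⁻¹ is total; its value at 0# is unspecified.
  field
    _<_                : Rel Carrier ℓ₂
    isStrictTotalOrder : IsStrictTotalOrder _≈_ _<_
    _⁻¹                : Carrier → Carrier
    ⁻¹-cong            : ∀ {x y} → x ≈ y → x ⁻¹ ≈ y ⁻¹
    ⁻¹-inverseʳ        : ∀ {x} → ¬ (x ≈ 0#) → x * x ⁻¹ ≈ 1#
    0<1                : 0# < 1#
    +-monoˡ-<          : ∀ {x y} z → x < y → x + z < y + z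
    *-pos              : ∀ {x y} → 0# < x → 0# < y → 0# < x * y

  open IsStrictTotalOrder isStrictTotalOrder public
    using (compare; _≟_; _<?_)
  open RawMonoidDefs (RawRing.+-rawMonoid (CommutativeRing.rawRing commutativeRing))
    renaming (_×_ to _·_) using ()

  -- |s m - s n| < ε for all m, n ≥ N; one inequality suffices, as m and n may
  -- be exchanged.
  Cauchy : (ℕ → Carrier) → Set (c ⊔ ℓ₂)
  Cauchy s = ∀ ε → 0# < ε → ∃[ N ] ∀ m n → N ℕ.≤ m → N ℕ.≤ n → s m - s n < ε

  Limit : (ℕ → Carrier) → Carrier → Set (c ⊔ ℓ₂)
  Limit s x = ∀ ε → 0# < ε →
    ∃[ N ] ∀ n → N ℕ.≤ n → (s n - x < ε) × (x - s n < ε)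

  field
    archimedean : ∀ x → ∃[ n ] x < n · 1#
    complete    : ∀ s → Cauchy s → ∃[ x ] Limit s x

module Complex {c ℓ₁ ℓ₂} (ℝ : CompleteOrderedField c ℓ₁ ℓ₂) where

  private module R = CompleteOrderedField ℝ

  record ℂ : Set c where
    constructor _+i_
    field
      re im : R.Carrier
  open ℂ public

  infix 4 _≈_ _≉_ _≟_
  record _≈_ (z w : ℂ) : Set ℓ₁ where
    constructor _,_
    field
      re≈ : re z R.≈ re w
      im≈ : im z R.≈ im w
  open _≈_ public

  _≉_ : ℂ → ℂ → Set ℓ₁
  z ≉ w = ¬ (z ≈ w)

  ℂ-setoid : Setoid c ℓ₁
  ℂ-setoid = record
    { Carrier = ℂ
    ; _≈_ = _≈_
    ; isEquivalence = record
      { refl  = R.refl , R.refl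
      ; sym   = λ e → R.sym (re≈ e) , R.sym (im≈ e)
      ; trans = λ e f → R.trans (re≈ e) (re≈ f) , R.trans (im≈ e) (im≈ f)
      }
    }

  _≟_ : Decidable _≈_
  z ≟ w = map′ (λ (e , f) → e , f) (λ e → re≈ e , im≈ e)
               ((re z R.≟ re w) ×-dec (im z R.≟ im w))

  infixl 6 _+_ _-_
  infixl 7 _*_ _/_
  infix  8 -_
  infix  9 _⁻¹

  0# 1# : ℂ
  0# = R.0# +i R.0#
  1# = R.1# +i R.0#

  _+_ _*_ : ℂ → ℂ → ℂ
  z + w = (re z R.+ re w) +i (im z R.+ im w)
  z * w = (re z R.* re w R.- im z R.* im w) +i (re z R.* im w R.+ im z R.* re w)

  -_ : ℂ → ℂ
  - z = (R.- re z) +i (R.- im z)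

  _-_ : ℂ → ℂ → ℂ
  z - w = z + (- w)

  normSq : ℂ → R.Carrier
  normSq z = re z R.* re z R.+ im z R.* im z

  _⁻¹ : ℂ → ℂ
  z ⁻¹ = (re z R.* normSq z R.⁻¹) +i (R.- im z R.* normSq z R.⁻¹)

  _/_ : ℂ → ℂ → ℂ
  z / w = z * w ⁻¹

  ℂ-rawRing : RawRing c ℓ₁
  ℂ-rawRing = record
    { Carrier = ℂ ; _≈_ = _≈_ ; _+_ = _+_ ; _*_ = _*_ ; -_ = -_ ; 0# = 0# ; 1# = 1# }

  open RawSemiringDefs (RawRing.rawSemiring ℂ-rawRing) public
    using (_^_; sum; product)
  open RawSemiringDefs (RawRing.rawSemiring ℂ-rawRing)
    renaming (_×_ to _·_) using ()

  ofℕ : ℕ → ℂ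
  ofℕ n = n · 1#

  𝟙[_] : ∀ {a} {P : Set a} → Dec P → ℂ
  𝟙[ P? ] = if does P? then 1# else 0#

  -- |z| < r, without square roots.
  ∣_∣<_ : ℂ → R.Carrier → Set ℓ₂
  ∣ z ∣< r = (R.0# R.< r) × (normSq z R.< r R.* r)

  ∣_∣<1 : ℂ → Set ℓ₂
  ∣ z ∣<1 = ∣ z ∣< R.1#

  ----------------------------------------------------------------------
  -- Polynomials, their zeros, and moments

  -- Coefficients, constant term first.
  Polynomial : Set c
  Polynomial = List ℂ

  eval : Polynomial → ℂ → ℂ
  eval f t = foldr (λ a b → a + t * b) 0# f

  -- α lists the zeros of the (nonzero) polynomial f with multiplicity.
  IsZeroListing : Polynomial → ∀ {d} → Vector ℂ d → Set (c ⊔ ℓ₁)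
  IsZeroListing f α = ∃[ a ] (a ≉ 0#) ×
    (∀ t → eval f t ≈ a * product (λ i → t - α i))

  -- Δ is the polynomial (t^{pq} - 1)(t - 1) / ((t^p - 1)(t^q - 1)).  Since ℂ is
  -- infinite, an identity of polynomial functions is one of polynomials.
  IsAlexanderPolynomial : ℕ → ℕ → Polynomial → Set (c ⊔ ℓ₁)
  IsAlexanderPolynomial p q Δ = ∀ t →
    eval Δ t * ((t ^ p - 1#) * (t ^ q - 1#)) ≈ (t ^ (p ℕ.* q) - 1#) * (t - 1#)

  moment : ∀ {d} → Vector ℂ d → ℕ → ℂ
  moment α m = sum (λ i → α i ^ m)

  ----------------------------------------------------------------------
  -- Complex analysis

  HasSum : (ℕ → ℂ) → ℂ → Set (c ⊔ ℓ₂)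
  HasSum a s = ∀ ε → R.0# R.< ε → ∃[ N ] ∀ n → N ℕ.≤ n →
    ∣ sum {n} (λ i → a (toℕ i)) - s ∣< ε

  -- ∀ᶠ over a (punctured) disc about w.
  Near Near≠ : ∀ {ℓ} → ℂ → (ℂ → Set ℓ) → Set _
  Near  w P = ∃[ ρ ] (R.0# R.< ρ) × (∀ z → ∣ z - w ∣< ρ → P z)
  Near≠ w P = Near w (λ z → z ≉ w → P z)

  LimitAt : (ℂ → ℂ) → ℂ → ℂ → Set (c ⊔ ℓ₁ ⊔ ℓ₂)
  LimitAt g w l = ∀ ε → R.0# R.< ε → Near≠ w (λ z → ∣ g z - l ∣< ε)

  Function : Set (c ⊔ ℓ₁)
  Function = ℂ-setoid ⟶ₛ ℂ-setoid

  DifferentiableAt : Function → ℂ → Set (c ⊔ ℓ₁ ⊔ ℓ₂)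
  DifferentiableAt f w =
    ∃[ f′ ] LimitAt (λ z → ((f ⟨$⟩ z) - (f ⟨$⟩ w)) / (z - w)) w f′

  HolomorphicAt : Function → ℂ → Set (c ⊔ ℓ₁ ⊔ ℓ₂)
  HolomorphicAt f w = Near w (DifferentiableAt f)

  -- Near w, off w itself, F has a Laurent expansion with principal part
  -- Σ_{k<n} b k (z - w)^{-(k+1)}.  The value of F at w is irrelevant.
  HasPrincipalPart : Function → ℂ → (n : ℕ) → Vector ℂ n → Set (c ⊔ ℓ₁ ⊔ ℓ₂)
  HasPrincipalPart F w n b = Σ Function λ h → HolomorphicAt h w ×
    Near≠ w (λ z → (F ⟨$⟩ z) ≈ sum (λ k → b k / (z - w) ^ suc (toℕ k)) + (h ⟨$⟩ z))

  MeromorphicAt : Function → ℂ → Set (c ⊔ ℓ₁ ⊔ ℓ₂)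
  MeromorphicAt F w = ∃[ n ] ∃[ b ] HasPrincipalPart F w n b

  -- Removable singularities do not count as singularities.
  SingularAt : Function → ℂ → Set (c ⊔ ℓ₁ ⊔ ℓ₂)
  SingularAt F w = ¬ HasPrincipalPart F w 0 (λ ())

  HasSimplePole : Function → ℂ → Set (c ⊔ ℓ₁ ⊔ ℓ₂)
  HasSimplePole F w = ∃[ b ] (b ≉ 0#) × HasPrincipalPart F w 1 (λ _ → b)

  HasResidue : Function → ℂ → ℂ → Set (c ⊔ ℓ₁ ⊔ ℓ₂)
  HasResidue F w r = ∃[ n ] Σ (Vector ℂ (suc n)) λ b →
    HasPrincipalPart F w (suc n) b × (b Fin.zero ≈ r)

  -- ξ^r = 1 for some r ∈ {1, p, q, pq}.
  IsRootOfUnity : ℕ → ℕ → ℂ → Set ℓ₁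
  IsRootOfUnity p q ξ = Any (λ r → ξ ^ r ≈ 1#) (1 ∷ p ∷ q ∷ p ℕ.* q ∷ [])

{-# OPTIONS --safe #-}

-- For |z| < 1 the moment series is Σᵢ 1/(1 - αᵢz), a sum of geometric series:
-- each αᵢ is a (pq)-th root of unity, so (αᵢz)^{pq} = z^{pq} and |αᵢz| < 1.
-- Taking logarithmic derivatives of
--   Δ(t) (t^p - 1)(t^q - 1) = (t^{pq} - 1)(t - 1)
-- at t = 1/z turns that sum into the closed form when z ≠ 0; the value at z = 0
-- follows by continuity.  At w with w^r = 1, dividing t^r - 1 by t - w twice gives
-- 1 - z^r = -(z - w)Q(z) and Q(z) - Q(w) = (z - w)Q₂(z) with Q(w) = r w^{r-1}, so
--   r/(1 - z^r) = -(r/Q(w))/(z - w) + r Q₂(z)/(Q(z)Q(w)),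
-- a simple pole of residue -w^{-(r-1)}.
module Submission where

open import Defs
import Algebra.Definitions.RawSemiring as RawSemiringDefs
import Algebra.Properties.AbelianGroup
import Algebra.Properties.CommutativeSemiring.Exp
import Algebra.Properties.Ring
import Algebra.Properties.Semiring.Exp
import Algebra.Properties.Semiring.Mult
import Algebra.Properties.Semiring.Mult.TCOptimised
import Algebra.Properties.Semiring.Sum
import Algebra.Solver.Ring
open import Algebra.Bundles using (CommutativeRing; CommutativeSemiring)
open import Algebra.Solver.Ring.AlmostCommutativeRing
  using (_-Raw-AlmostCommutative⟶_; fromCommutativeRing; Induced-equivalence)
open import Data.Bool.Base using (if_then_else_)
open import Data.Empty using (⊥-elim)
open import Data.Fin.Base as Fin using (toℕ)
open import Data.Integer.Base as ℤ using (ℤ; +_; -[1+_]; _⊖_)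
import Data.Integer.Properties as ℤ
open import Data.List.Base using (List; []; _∷_; foldr)
open import Data.List.Relation.Unary.Any using (here; there; any?)
open import Data.Maybe.Base using (just; nothing)
open import Data.Nat.Base as ℕ using (ℕ; zero; suc; NonZero; _∸_)
open import Data.Nat.Coprimality using (Coprime)
import Data.Nat.Properties as ℕ
open import Data.Product.Base using (Σ; ∃-syntax; _×_; _,_; proj₁; proj₂)
open import Data.Sum.Base using (_⊎_; inj₁; inj₂)
open import Data.Vec.Functional using (Vector)
open import Function.Base using (_∘_)
open import Function.Bundles using (_⟨$⟩_)
open import Level using (_⊔_) renaming (suc to lsuc)
open import Relation.Binary.Bundles using (Setoid; StrictPartialOrder)
import Relation.Binary.Construct.StrictToNonStrict
open import Relation.Binary.Definitions using (Decidable; WeaklyDecidable; tri<; tri≈; tri>)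
import Relation.Binary.PropositionalEquality as ≡
import Relation.Binary.Reasoning.Setoid
import Relation.Binary.Reasoning.StrictPartialOrder
open import Relation.Binary.Structures using (IsStrictTotalOrder)
open import Relation.Nullary using (¬_; Dec; yes; no; does; contradiction)

-- About `α` nothing is known except the polynomial identity, so its entries are never enumerated as
-- explicit roots of unity; differentiating the identity is what makes their power sums accessible.
-- The point t = 1/z is chosen because |t| > 1: the right-hand side cannot vanish there, hence no
-- factor t - αᵢ can, and dividing by both sides is legitimate. Only z = 0 has no such t, which is
-- why that value needs a limit.
--
-- The residue formula follows by linearity once each r/(1 - z^r) has a principal part at every
-- point, with coefficient 0 away from the r-th roots of unity. The four contributions may cancel,
-- for instance -1 + 1 + 1 - 1 at ξ = 1, so a root of unity need not be a singularity; the claim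
-- about simple poles is split on whether the total coefficient is 0.
--
-- The reals come without square roots, so |z| is never a number: estimates use the predicate |z| <
-- r, and a lower bound on |z| is the negation of that predicate.

-- A ring solver with integer coefficients.

module IntegerSolver {c ℓ} (R : CommutativeRing c ℓ) where
  open CommutativeRing R
  open Algebra.Properties.Ring ring
  open Algebra.Properties.AbelianGroup +-abelianGroup using (⁻¹-∙-comm)
  open Algebra.Properties.Semiring.Mult.TCOptimised semiring
    using (×-homo-+; ×1-homo-*; 1+×) renaming (_×_ to _·_)
  open Relation.Binary.Reasoning.Setoid setoid

  -- The `TCOptimised` multiple makes `1 · 1#` compute to `1#`, so in solver goals `con (+ 0)` and
  -- `con (+ 1)` are `0#` and `1#` on the nose.
  fromℤ : ℤ → Carrier
  fromℤ (+ n)    = n · 1#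
  fromℤ -[1+ n ] = - (suc n · 1#)

  private
    cancel-1+ : ∀ x y → (1# + x) - (1# + y) ≈ x - y
    cancel-1+ x y = begin
      (1# + x) - (1# + y)        ≈⟨ +-congˡ (⁻¹-∙-comm 1# y) ⟨
      (1# + x) + (- 1# + - y)    ≈⟨ +-congʳ (+-comm 1# x) ⟩
      (x + 1#) + (- 1# + - y)    ≈⟨ +-assoc x 1# _ ⟩
      x + (1# + (- 1# + - y))    ≈⟨ +-congˡ (+-assoc 1# (- 1#) (- y)) ⟨
      x + ((1# - 1#) + - y)      ≈⟨ +-congˡ (+-congʳ (-‿inverseʳ 1#)) ⟩
      x + (0# + - y)             ≈⟨ +-congˡ (+-identityˡ (- y)) ⟩
      x - y                      ∎

  -- Integer addition of mixed signs unfolds to `⊖`, so this is the substance of `fromℤ-+`.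
  fromℤ-⊖ : ∀ m n → fromℤ (m ⊖ n) ≈ m · 1# - n · 1#
  fromℤ-⊖ m       zero    = sym (trans (+-congˡ -0#≈0#) (+-identityʳ _))
  fromℤ-⊖ zero    (suc n) = sym (+-identityˡ _)
  fromℤ-⊖ (suc m) (suc n) = begin
    fromℤ (suc m ⊖ suc n)          ≡⟨ ≡.cong fromℤ (ℤ.[1+m]⊖[1+n]≡m⊖n m n) ⟩
    fromℤ (m ⊖ n)                  ≈⟨ fromℤ-⊖ m n ⟩
    m · 1# - n · 1#                ≈⟨ cancel-1+ _ _ ⟨
    (1# + m · 1#) - (1# + n · 1#)  ≈⟨ +-cong (1+× m 1#) (-‿cong (1+× n 1#)) ⟨
    suc m · 1# - suc n · 1#        ∎

  fromℤ-neg : ∀ i → fromℤ (ℤ.- i) ≈ - fromℤ i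
  fromℤ-neg (+ zero)  = sym -0#≈0#
  fromℤ-neg (+ suc n) = refl
  fromℤ-neg -[1+ n ]  = sym (-‿involutive _)

  fromℤ-+ : ∀ i j → fromℤ (i ℤ.+ j) ≈ fromℤ i + fromℤ j
  fromℤ-+ (+ m)    (+ n)    = ×-homo-+ 1# m n
  fromℤ-+ (+ m)    -[1+ n ] = fromℤ-⊖ m (suc n)
  fromℤ-+ -[1+ m ] (+ n)    = trans (fromℤ-⊖ n (suc m)) (+-comm _ _)
  fromℤ-+ -[1+ m ] -[1+ n ] = begin
    - (suc (suc (m ℕ.+ n)) · 1#)      ≡⟨ ≡.cong (λ k → - (suc k · 1#)) (ℕ.+-suc m n) ⟨
    - ((suc m ℕ.+ suc n) · 1#)        ≈⟨ -‿cong (×-homo-+ 1# (suc m) (suc n)) ⟩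
    - (suc m · 1# + suc n · 1#)       ≈⟨ ⁻¹-∙-comm _ _ ⟨
    - (suc m · 1#) + - (suc n · 1#)   ∎

  private
    fromℤ-*⁺ : ∀ m j → fromℤ (+ m ℤ.* j) ≈ m · 1# * fromℤ j
    fromℤ-*⁺ m (+ n) = begin
      fromℤ (+ m ℤ.* + n)   ≡⟨ ≡.cong fromℤ (ℤ.pos-* m n) ⟨
      (m ℕ.* n) · 1#        ≈⟨ ×1-homo-* m n ⟩
      m · 1# * n · 1#       ∎
    fromℤ-*⁺ m -[1+ n ] = begin
      fromℤ (+ m ℤ.* -[1+ n ])            ≡⟨ ≡.cong fromℤ (ℤ.neg-distribʳ-* (+ m) (+ suc n)) ⟨
      fromℤ (ℤ.- (+ m ℤ.* + suc n))       ≈⟨ fromℤ-neg (+ m ℤ.* + suc n) ⟩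
      - fromℤ (+ m ℤ.* + suc n)           ≈⟨ -‿cong (fromℤ-*⁺ m (+ suc n)) ⟩
      - (m · 1# * suc n · 1#)             ≈⟨ -‿distribʳ-* _ _ ⟩
      m · 1# * - (suc n · 1#)             ∎

  fromℤ-* : ∀ i j → fromℤ (i ℤ.* j) ≈ fromℤ i * fromℤ j
  fromℤ-* (+ m)    j = fromℤ-*⁺ m j
  fromℤ-* -[1+ m ] j = begin
    fromℤ (-[1+ m ] ℤ.* j)           ≡⟨ ≡.cong fromℤ (ℤ.neg-distribˡ-* (+ suc m) j) ⟨
    fromℤ (ℤ.- (+ suc m ℤ.* j))      ≈⟨ fromℤ-neg (+ suc m ℤ.* j) ⟩
    - fromℤ (+ suc m ℤ.* j)          ≈⟨ -‿cong (fromℤ-*⁺ (suc m) j) ⟩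
    - (suc m · 1# * fromℤ j)         ≈⟨ -‿distribˡ-* _ _ ⟩
    - (suc m · 1#) * fromℤ j         ∎

  private
    morphism : ℤ.+-*-rawRing -Raw-AlmostCommutative⟶ fromCommutativeRing R
    morphism = record
      { ⟦_⟧ = fromℤ ; +-homo = fromℤ-+ ; *-homo = fromℤ-* ; -‿homo = fromℤ-neg
      ; 0-homo = refl ; 1-homo = refl }

    _coeff≟_ : WeaklyDecidable (Induced-equivalence morphism)
    i coeff≟ j with i ℤ.≟ j
    ... | yes ≡.refl = just refl
    ... | no _       = nothing

  open Algebra.Solver.Ring ℤ.+-*-rawRing (fromCommutativeRing R) morphism _coeff≟_ public
    using (solve; con; _:=_; _:+_; _:*_; :-_; _:-_)

-- Order, inverses and vanishing powers in the reals.

module OrderedField {c ℓ₁ ℓ₂} (ℝ : CompleteOrderedField c ℓ₁ ℓ₂) where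
  open CompleteOrderedField ℝ
  open IntegerSolver commutativeRing
  open Relation.Binary.Construct.StrictToNonStrict _≈_ _<_ public using (_≤_; <⇒≤)
  open Algebra.Properties.Semiring.Exp semiring using (_^_; ^-congˡ)
  open Algebra.Properties.Semiring.Mult semiring using (×-homo-+) renaming (_×_ to _·_)

  private module O = IsStrictTotalOrder isStrictTotalOrder

  open O public using () renaming
    (irrefl to <-irrefl; <-respˡ-≈ to <-respˡ; <-respʳ-≈ to <-respʳ)

  strictPartialOrder : StrictPartialOrder c ℓ₁ ℓ₂
  strictPartialOrder = record { isStrictPartialOrder = O.isStrictPartialOrder }

  module ≤-Reasoning = Relation.Binary.Reasoning.StrictPartialOrder strictPartialOrder
  open ≤-Reasoning

  pos⇒≉0 : ∀ {x} → 0# < x → ¬ (x ≈ 0#)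
  pos⇒≉0 0<x x≈0 = <-irrefl (sym x≈0) 0<x

  -- Reduces an inequality to a ring identity for the solver; only the sign of the difference is
  -- left to argue.
  difference⁺ : ∀ {x y} d → 0# < d → y ≈ x + d → x < y
  difference⁺ {x} {y} d 0<d y≈x+d = begin-strict
    x       ≈⟨ +-identityˡ x ⟨
    0# + x  <⟨ +-monoˡ-< x 0<d ⟩
    d + x   ≈⟨ +-comm d x ⟩
    x + d   ≈⟨ y≈x+d ⟨
    y       ∎

  x<y⇒0<y-x : ∀ {x y} → x < y → 0# < y - x
  x<y⇒0<y-x {x} {y} x<y = begin-strict
    0#     ≈⟨ -‿inverseʳ x ⟨
    x - x  <⟨ +-monoˡ-< (- x) x<y ⟩
    y - x  ∎

  0<y-x⇒x<y : ∀ {x y} → 0# < y - x → x < y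
  0<y-x⇒x<y {x} {y} p =
    difference⁺ (y - x) p (solve 2 (λ x y → y := x :+ (y :- x)) refl x y)

  x≤y⇒0≤y-x : ∀ {x y} → x ≤ y → 0# ≤ y - x
  x≤y⇒0≤y-x (inj₁ x<y) = inj₁ (x<y⇒0<y-x x<y)
  x≤y⇒0≤y-x (inj₂ x≈y) = inj₂ (sym (trans (+-congˡ (-‿cong x≈y)) (-‿inverseʳ _)))

  difference⁰ : ∀ {x y} d → 0# ≤ d → y ≈ x + d → x ≤ y
  difference⁰ d (inj₁ 0<d) y≈x+d = inj₁ (difference⁺ d 0<d y≈x+d)
  difference⁰ d (inj₂ 0≈d) y≈x+d =
    inj₂ (sym (trans y≈x+d (trans (+-congˡ (sym 0≈d)) (+-identityʳ _))))

  +-nonneg-pos : ∀ {x y} → 0# ≤ x → 0# < y → 0# < x + y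
  +-nonneg-pos {x} {y} 0≤x 0<y = begin-strict
    0#      ≤⟨ 0≤x ⟩
    x       <⟨ difference⁺ y 0<y refl ⟩
    x + y   ∎

  +-pos : ∀ {x y} → 0# < x → 0# < y → 0# < x + y
  +-pos 0<x = +-nonneg-pos (<⇒≤ 0<x)

  +-pos-nonneg : ∀ {x y} → 0# < x → 0# ≤ y → 0# < x + y
  +-pos-nonneg 0<x 0≤y = <-respʳ (+-comm _ _) (+-nonneg-pos 0≤y 0<x)

  +-nonneg : ∀ {x y} → 0# ≤ x → 0# ≤ y → 0# ≤ x + y
  +-nonneg 0≤x (inj₁ 0<y) = inj₁ (+-nonneg-pos 0≤x 0<y)
  +-nonneg {x} {y} 0≤x (inj₂ 0≈y) = begin
    0#      ≤⟨ 0≤x ⟩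
    x       ≈⟨ +-identityʳ x ⟨
    x + 0#  ≈⟨ +-congˡ 0≈y ⟩
    x + y   ∎

  *-nonneg : ∀ {x y} → 0# ≤ x → 0# ≤ y → 0# ≤ x * y
  *-nonneg (inj₁ 0<x) (inj₁ 0<y) = inj₁ (*-pos 0<x 0<y)
  *-nonneg {x} {y} (inj₂ 0≈x) _  = inj₂ (trans (sym (zeroˡ y)) (*-congʳ 0≈x))
  *-nonneg {x} {y} _ (inj₂ 0≈y)  = inj₂ (trans (sym (zeroʳ x)) (*-congˡ 0≈y))

  ≤-<-connex : ∀ x y → x ≤ y ⊎ y < x
  ≤-<-connex x y with compare x y
  ... | tri< x<y _ _ = inj₁ (inj₁ x<y)
  ... | tri≈ _ x≈y _ = inj₁ (inj₂ x≈y)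
  ... | tri> _ _ y<x = inj₂ y<x

  ≤⇒≯ : ∀ {x y} → x ≤ y → ¬ (y < x)
  ≤⇒≯ {x} {y} x≤y y<x = <-irrefl refl (begin-strict x ≤⟨ x≤y ⟩ y <⟨ y<x ⟩ x ∎)

  neg-pos : ∀ {x} → x < 0# → 0# < - x
  neg-pos x<0 = <-respʳ (+-identityˡ _) (x<y⇒0<y-x x<0)

  square-pos : ∀ {x} → ¬ (x ≈ 0#) → 0# < x * x
  square-pos {x} x≉0 with compare x 0#
  ... | tri< x<0 _ _ = <-respʳ (solve 1 (λ x → :- x :* :- x := x :* x) refl x)
                               (*-pos (neg-pos x<0) (neg-pos x<0))
  ... | tri≈ _ x≈0 _ = contradiction x≈0 x≉0
  ... | tri> _ _ 0<x = *-pos 0<x 0<x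

  square-nonneg : ∀ x → 0# ≤ x * x
  square-nonneg x with x ≟ 0#
  ... | yes x≈0 = inj₂ (sym (trans (*-congˡ x≈0) (zeroʳ x)))
  ... | no  x≉0 = inj₁ (square-pos x≉0)

  -- Were y negative, x y and x (- y) would both be positive, although their sum is 0.
  *-cancelˡ-pos : ∀ {x y} → 0# < x → 0# < x * y → 0# < y
  *-cancelˡ-pos {x} {y} 0<x 0<xy with compare y 0#
  ... | tri> _ _ 0<y = 0<y
  ... | tri≈ _ y≈0 _ = contradiction (trans (*-congˡ y≈0) (zeroʳ x)) (pos⇒≉0 0<xy)
  ... | tri< y<0 _ _ = ⊥-elim (<-irrefl refl (begin-strict
    0#                 <⟨ +-pos 0<xy (*-pos 0<x (neg-pos y<0)) ⟩
    x * y + x * (- y)  ≈⟨ solve 2 (λ x y → x :* y :+ x :* (:- y) := con (+ 0)) refl x y ⟩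
    0#                 ∎))

  *-cancelˡ-< : ∀ {z x y} → 0# < z → z * x < z * y → x < y
  *-cancelˡ-< {z} {x} {y} 0<z p = 0<y-x⇒x<y (*-cancelˡ-pos 0<z
    (<-respʳ (solve 3 (λ x y z → z :* y :- z :* x := z :* (y :- x)) refl x y z) (x<y⇒0<y-x p)))

  *-monoˡ-< : ∀ {z x y} → 0# < z → x < y → z * x < z * y
  *-monoˡ-< {z} {x} {y} 0<z x<y = difference⁺ (z * (y - x)) (*-pos 0<z (x<y⇒0<y-x x<y))
    (solve 3 (λ x y z → z :* y := z :* x :+ z :* (y :- x)) refl x y z)

  *-monoˡ-≤ : ∀ {z x y} → 0# ≤ z → x ≤ y → z * x ≤ z * y
  *-monoˡ-≤ {z} {x} {y} 0≤z x≤y = difference⁰ (z * (y - x)) (*-nonneg 0≤z (x≤y⇒0≤y-x x≤y))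
    (solve 3 (λ x y z → z :* y := z :* x :+ z :* (y :- x)) refl x y z)

  square-mono-≤ : ∀ {x y} → 0# ≤ x → x ≤ y → x * x ≤ y * y
  square-mono-≤ {x} {y} 0≤x x≤y = begin
    x * x  ≤⟨ *-monoˡ-≤ 0≤x x≤y ⟩
    x * y  ≈⟨ *-comm x y ⟩
    y * x  ≤⟨ *-monoˡ-≤ (begin 0# ≤⟨ 0≤x ⟩ x ≤⟨ x≤y ⟩ y ∎) x≤y ⟩
    y * y  ∎

  ⁻¹-pos : ∀ {x} → 0# < x → 0# < x ⁻¹
  ⁻¹-pos 0<x = *-cancelˡ-pos 0<x (<-respʳ (sym (⁻¹-inverseʳ (pos⇒≉0 0<x))) 0<1)

  ∃-min : ∀ {x y} → 0# < x → 0# < y → ∃[ m ] 0# < m × m ≤ x × m ≤ y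
  ∃-min {x} {y} 0<x 0<y with ≤-<-connex x y
  ... | inj₁ x≤y = x , 0<x , inj₂ refl , x≤y
  ... | inj₂ y<x = y , 0<y , inj₁ y<x , inj₂ refl

  -- Square roots are avoided by bounding from below.
  ∃-square≤ : ∀ {x} → 0# < x → ∃[ r ] 0# < r × r * r ≤ x
  ∃-square≤ {x} 0<x with ∃-min 0<x 0<1
  ... | r , 0<r , r≤x , r≤1 = r , 0<r , (begin
    r * r   ≤⟨ *-monoˡ-≤ (<⇒≤ 0<r) r≤1 ⟩
    r * 1#  ≈⟨ *-identityʳ r ⟩
    r       ≤⟨ r≤x ⟩
    x       ∎)

  0<2 : 0# < 1# + 1#
  0<2 = +-pos 0<1 0<1

  ∃-half : ∀ {x} → 0# < x → ∃[ h ] 0# < h × h + h ≈ x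
  ∃-half {x} 0<x = x * ½ , *-pos 0<x (⁻¹-pos 0<2) , (begin-equality
    x * ½ + x * ½        ≈⟨ solve 2 (λ x h → x :* h :+ x :* h := x :* ((con (+ 1) :+ con (+ 1)) :* h)) refl x ½ ⟩
    x * ((1# + 1#) * ½)  ≈⟨ *-congˡ (⁻¹-inverseʳ (pos⇒≉0 0<2)) ⟩
    x * 1#               ≈⟨ *-identityʳ x ⟩
    x                    ∎)
    where ½ = (1# + 1#) ⁻¹

  ∃-quotient : ∀ {x y} → 0# < x → 0# < y → ∃[ d ] 0# < d × y * d ≈ x
  ∃-quotient {x} {y} 0<x 0<y = y ⁻¹ * x , *-pos (⁻¹-pos 0<y) 0<x , (begin-equality
    y * (y ⁻¹ * x)  ≈⟨ *-assoc y (y ⁻¹) x ⟨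
    (y * y ⁻¹) * x  ≈⟨ *-congʳ (⁻¹-inverseʳ (pos⇒≉0 0<y)) ⟩
    1# * x          ≈⟨ *-identityˡ x ⟩
    x               ∎)

  ^-nonneg : ∀ {x} → 0# ≤ x → ∀ n → 0# ≤ x ^ n
  ^-nonneg 0≤x zero    = inj₁ 0<1
  ^-nonneg 0≤x (suc n) = *-nonneg 0≤x (^-nonneg 0≤x n)

  1≤^ : ∀ {x} → 1# ≤ x → ∀ n → 1# ≤ x ^ n
  1≤^ 1≤x zero = inj₂ refl
  1≤^ {x} 1≤x (suc n) = begin
    1#        ≤⟨ 1≤x ⟩
    x         ≈⟨ *-identityʳ x ⟨
    x * 1#    ≤⟨ *-monoˡ-≤ (begin 0# <⟨ 0<1 ⟩ 1# ≤⟨ 1≤x ⟩ x ∎) (1≤^ 1≤x n) ⟩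
    x * x ^ n ∎

  ·1-nonneg : ∀ n → 0# ≤ n · 1#
  ·1-nonneg zero    = inj₂ refl
  ·1-nonneg (suc n) = inj₁ (+-pos-nonneg 0<1 (·1-nonneg n))

  ·1-mono-≤ : ∀ {m n} → m ℕ.≤ n → m · 1# ≤ n · 1#
  ·1-mono-≤ {m} {n} m≤n = difference⁰ _ (·1-nonneg (n ℕ.∸ m))
    (trans (reflexive (≡.cong (_· 1#) (≡.sym (ℕ.m+[n∸m]≡n m≤n)))) (×-homo-+ 1# m (n ℕ.∸ m)))

  -- A division-free form of (1 - h)^n ≤ 1/(1 + nh). Passing from n to n + 1 lowers the left side by
  -- (1 - h)^n (n + 1) h², which is nonnegative.
  bernoulli : ∀ {h} → 0# ≤ h → h ≤ 1# → ∀ n → (1# - h) ^ n * (1# + n · 1# * h) ≤ 1#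
  bernoulli {h} 0≤h h≤1 zero = inj₂
    (solve 1 (λ h → con (+ 1) :* (con (+ 1) :+ con (+ 0) :* h) := con (+ 1)) refl h)
  bernoulli {h} 0≤h h≤1 (suc n) = begin
    (1# - h) * xⁿ * (1# + (1# + N) * h)
      ≤⟨ difference⁰ (xⁿ * ((1# + N) * (h * h)))
           (*-nonneg (^-nonneg (x≤y⇒0≤y-x h≤1) n)
             (*-nonneg (·1-nonneg (suc n)) (square-nonneg h)))
           (solve 3 (λ h N X → X :* (con (+ 1) :+ N :* h)
              := (con (+ 1) :- h) :* X :* (con (+ 1) :+ (con (+ 1) :+ N) :* h)
                 :+ X :* ((con (+ 1) :+ N) :* (h :* h))) refl h N xⁿ) ⟩
    xⁿ * (1# + N * h)  ≤⟨ bernoulli 0≤h h≤1 n ⟩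
    1#                 ∎
    where
    xⁿ = (1# - h) ^ n
    N  = n · 1#

  -- With h = 1 - x, `bernoulli` bounds x^n by 1/(1 + nh). The Archimedean axiom gives N > 1/(hε),
  -- and then (1 + nh)ε > nhε > 1 for n ≥ N.
  ^-vanishes : ∀ {x} → 0# ≤ x → x < 1# → ∀ {ε} → 0# < ε →
               ∃[ N ] ∀ n → N ℕ.≤ n → x ^ n < ε
  ^-vanishes {x} 0≤x x<1 {ε} 0<ε = N , λ n N≤n →
    let hε<n = begin-strict
          1#                          ≈⟨ ⁻¹-inverseʳ (pos⇒≉0 0<hε) ⟨
          hε * hε ⁻¹                  <⟨ *-monoˡ-< 0<hε hε⁻¹<N ⟩
          hε * N · 1#                 ≤⟨ *-monoˡ-≤ (<⇒≤ 0<hε) (·1-mono-≤ N≤n) ⟩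
          hε * n · 1#                 <⟨ difference⁺ ε 0<ε (solve 3 (λ h ε n →
                                          (con (+ 1) :+ n :* h) :* ε := (h :* ε) :* n :+ ε) refl h ε (n · 1#)) ⟩
          (1# + n · 1# * h) * ε       ∎
    in *-cancelˡ-< (+-pos-nonneg 0<1 (*-nonneg (·1-nonneg n) (<⇒≤ 0<h))) (begin-strict
      (1# + n · 1# * h) * x ^ n         ≈⟨ *-comm _ _ ⟩
      x ^ n * (1# + n · 1# * h)         ≈⟨ *-congʳ (^-congˡ n (solve 1 (λ x → x := con (+ 1) :- (con (+ 1) :- x)) refl x)) ⟩
      (1# - h) ^ n * (1# + n · 1# * h)  ≤⟨ bernoulli (<⇒≤ 0<h) h≤1 n ⟩
      1#                                <⟨ hε<n ⟩
      (1# + n · 1# * h) * ε             ∎)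
    where
    h   = 1# - x
    0<h : 0# < h
    0<h = x<y⇒0<y-x x<1
    h≤1 : h ≤ 1#
    h≤1 = difference⁰ x 0≤x (solve 1 (λ x → con (+ 1) := con (+ 1) :- x :+ x) refl x)
    hε  = h * ε
    0<hε : 0# < hε
    0<hε = *-pos 0<h 0<ε
    N   = proj₁ (archimedean (hε ⁻¹))
    hε⁻¹<N : hε ⁻¹ < N · 1#
    hε⁻¹<N = proj₂ (archimedean (hε ⁻¹))

module Reals {c ℓ₁ ℓ₂} (ℝ : CompleteOrderedField c ℓ₁ ℓ₂) where
  open CompleteOrderedField ℝ public
  open OrderedField ℝ public

-- The field ℂ and estimates for its norm.

module ComplexField {c ℓ₁ ℓ₂} (ℝ : CompleteOrderedField c ℓ₁ ℓ₂) where
  open Complex ℝ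
  private
    module R where
      open Reals ℝ public
      open IntegerSolver commutativeRing public
  open R using (solve; _:=_; _:+_; _:*_; _:-_; :-_; con; _≤_)

  ℂ-commutativeRing : CommutativeRing c ℓ₁
  ℂ-commutativeRing = record
    { isCommutativeRing = record
      { isRing = record
        { +-isAbelianGroup = record
          { isGroup = record
            { isMonoid = record
              { isSemigroup = record
                { isMagma = record
                  { isEquivalence = Setoid.isEquivalence ℂ-setoid
                  ; ∙-cong = λ (e , f) (g , h) → R.+-cong e g , R.+-cong f h }
                ; assoc = λ _ _ _ → R.+-assoc _ _ _ , R.+-assoc _ _ _ }
              ; identity = (λ _ → R.+-identityˡ _ , R.+-identityˡ _)
                         , (λ _ → R.+-identityʳ _ , R.+-identityʳ _) }
            ; inverse = (λ _ → R.-‿inverseˡ _ , R.-‿inverseˡ _)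
                      , (λ _ → R.-‿inverseʳ _ , R.-‿inverseʳ _)
            ; ⁻¹-cong = λ (e , f) → R.-‿cong e , R.-‿cong f }
          ; comm = λ _ _ → R.+-comm _ _ , R.+-comm _ _ }
        ; *-cong = λ (e , f) (g , h) →
            R.+-cong (R.*-cong e g) (R.-‿cong (R.*-cong f h)) ,
            R.+-cong (R.*-cong e h) (R.*-cong f g)
        ; *-assoc = λ (a +i b) (c +i d) (e +i f) →
            solve 6 (λ a b c d e f →
              (a :* c :- b :* d) :* e :- (a :* d :+ b :* c) :* f
              := a :* (c :* e :- d :* f) :- b :* (c :* f :+ d :* e)) R.refl a b c d e f ,
            solve 6 (λ a b c d e f →
              (a :* c :- b :* d) :* f :+ (a :* d :+ b :* c) :* e
              := a :* (c :* f :+ d :* e) :+ b :* (c :* e :- d :* f)) R.refl a b c d e f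
        ; *-identity =
            (λ (a +i b) →
              solve 2 (λ a b → con (+ 1) :* a :- con (+ 0) :* b := a) R.refl a b ,
              solve 2 (λ a b → con (+ 1) :* b :+ con (+ 0) :* a := b) R.refl a b) ,
            (λ (a +i b) →
              solve 2 (λ a b → a :* con (+ 1) :- b :* con (+ 0) := a) R.refl a b ,
              solve 2 (λ a b → a :* con (+ 0) :+ b :* con (+ 1) := b) R.refl a b)
        ; distrib =
            (λ (a +i b) (c +i d) (e +i f) →
              solve 6 (λ a b c d e f → a :* (c :+ e) :- b :* (d :+ f)
                := (a :* c :- b :* d) :+ (a :* e :- b :* f)) R.refl a b c d e f ,
              solve 6 (λ a b c d e f → a :* (d :+ f) :+ b :* (c :+ e)
                := (a :* d :+ b :* c) :+ (a :* f :+ b :* e)) R.refl a b c d e f) ,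
            (λ (a +i b) (c +i d) (e +i f) →
              solve 6 (λ a b c d e f → (c :+ e) :* a :- (d :+ f) :* b
                := (c :* a :- d :* b) :+ (e :* a :- f :* b)) R.refl a b c d e f ,
              solve 6 (λ a b c d e f → (c :+ e) :* b :+ (d :+ f) :* a
                := (c :* b :+ d :* a) :+ (e :* b :+ f :* a)) R.refl a b c d e f)
        }
      ; *-comm = λ (a +i b) (c +i d) →
          solve 4 (λ a b c d → a :* c :- b :* d := c :* a :- d :* b) R.refl a b c d ,
          solve 4 (λ a b c d → a :* d :+ b :* c := c :* b :+ d :* a) R.refl a b c d
      }
    }
  normSq-cong : ∀ {z w} → z ≈ w → normSq z R.≈ normSq w
  normSq-cong (e , f) = R.+-cong (R.*-cong e e) (R.*-cong f f)

  normSq-nonneg : ∀ z → R.0# ≤ normSq z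
  normSq-nonneg z = R.+-nonneg (R.square-nonneg (re z)) (R.square-nonneg (im z))

  normSq-pos : ∀ {z} → z ≉ 0# → R.0# R.< normSq z
  normSq-pos {z} z≉0 with re z R.≟ R.0# | im z R.≟ R.0#
  ... | no  a≉0 | _       = R.+-pos-nonneg (R.square-pos a≉0) (R.square-nonneg (im z))
  ... | yes _   | no  b≉0 = R.+-nonneg-pos (R.square-nonneg (re z)) (R.square-pos b≉0)
  ... | yes a≈0 | yes b≈0 = contradiction (a≈0 , b≈0) z≉0

  normSq-* : ∀ z w → normSq (z * w) R.≈ normSq z R.* normSq w
  normSq-* (a +i b) (c +i d) =
    solve 4 (λ a b c d → (a :* c :- b :* d) :* (a :* c :- b :* d)
                         :+ (a :* d :+ b :* c) :* (a :* d :+ b :* c)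
      := (a :* a :+ b :* b) :* (c :* c :+ d :* d)) R.refl a b c d

  normSq-neg : ∀ z → normSq (- z) R.≈ normSq z
  normSq-neg (a +i b) =
    solve 2 (λ a b → :- a :* :- a :+ :- b :* :- b := a :* a :+ b :* b) R.refl a b

  normSq-0 : normSq 0# R.≈ R.0#
  normSq-0 = solve 0 (con (+ 0) :* con (+ 0) :+ con (+ 0) :* con (+ 0) := con (+ 0)) R.refl

  normSq-1 : normSq 1# R.≈ R.1#
  normSq-1 = solve 0 (con (+ 1) :* con (+ 1) :+ con (+ 0) :* con (+ 0) := con (+ 1)) R.refl

  ⁻¹-cong : ∀ {z w} → z ≈ w → z ⁻¹ ≈ w ⁻¹
  ⁻¹-cong z≈w@(e , f) = R.*-cong e n , R.*-cong (R.-‿cong f) n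
    where n = R.⁻¹-cong (normSq-cong z≈w)

  ⁻¹-inverseʳ : ∀ {z} → z ≉ 0# → z * z ⁻¹ ≈ 1#
  ⁻¹-inverseʳ {z@(a +i b)} z≉0 =
    R.trans (solve 3 (λ a b n → a :* (a :* n) :- b :* (:- b :* n) := (a :* a :+ b :* b) :* n)
               R.refl a b n)
            (R.⁻¹-inverseʳ (R.pos⇒≉0 (normSq-pos z≉0))) ,
    solve 3 (λ a b n → a :* (:- b :* n) :+ b :* (a :* n) := con (+ 0)) R.refl a b n
    where n = normSq z R.⁻¹

  ∣∣<-cong : ∀ {z w r s} → z ≈ w → r R.≈ s → ∣ z ∣< r → ∣ w ∣< s
  ∣∣<-cong z≈w r≈s (0<r , p) =
    R.<-respʳ r≈s 0<r , R.<-respʳ (R.*-cong r≈s r≈s) (R.<-respˡ (normSq-cong z≈w) p)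

  ∣∣<-weaken : ∀ {z r s} → r ≤ s → ∣ z ∣< r → ∣ z ∣< s
  ∣∣<-weaken {z} {r} {s} r≤s (0<r , p) =
    (begin-strict R.0# <⟨ 0<r ⟩ r ≤⟨ r≤s ⟩ s ∎) ,
    (begin-strict normSq z <⟨ p ⟩ r R.* r ≤⟨ R.square-mono-≤ (R.<⇒≤ 0<r) r≤s ⟩ s R.* s ∎)
    where open R.≤-Reasoning

  ∣0∣< : ∀ {r} → R.0# R.< r → ∣ 0# ∣< r
  ∣0∣< 0<r = 0<r , R.<-respˡ (R.sym normSq-0) (R.*-pos 0<r 0<r)

  ∣∣<-neg : ∀ {z r} → ∣ z ∣< r → ∣ - z ∣< r
  ∣∣<-neg {z} (0<r , p) = 0<r , R.<-respˡ (R.sym (normSq-neg z)) p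

  -- With ⟨z,w⟩ the real inner product, 2rs(rs - ⟨z,w⟩) equals
  -- s²(r² - |z|²) + r²(s² - |w|²) + |sz - rw|², hence is positive.
  ∣∣<-+ : ∀ {z w r s} → ∣ z ∣< r → ∣ w ∣< s → ∣ z + w ∣< (r R.+ s)
  ∣∣<-+ {z@(a +i b)} {w@(c +i d)} {r} {s} (0<r , p) (0<s , q) =
    R.+-pos 0<r 0<s ,
    R.0<y-x⇒x<y (R.*-cancelˡ-pos (R.*-pos 0<r 0<s) (R.<-respʳ
      (solve 6 (λ a b c d r s →
          let n = a :* a :+ b :* b; m = c :* c :+ d :* d
              u = s :* a :- r :* c; v = s :* b :- r :* d in
          r :* s :* ((r :* r :- n) :+ (s :* s :- m))
            :+ (s :* s :* (r :* r :- n) :+ r :* r :* (s :* s :- m)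
            :+ (u :* u :+ v :* v))
          := r :* s :* ((r :+ s) :* (r :+ s)
                :- ((a :+ c) :* (a :+ c) :+ (b :+ d) :* (b :+ d))))
        R.refl a b c d r s)
      (R.+-pos (R.*-pos (R.*-pos 0<r 0<s) (R.+-pos p′ q′))
        (R.+-pos-nonneg (R.+-pos (R.*-pos (R.*-pos 0<s 0<s) p′) (R.*-pos (R.*-pos 0<r 0<r) q′))
          (R.+-nonneg (R.square-nonneg _) (R.square-nonneg _))))))
    where
    p′ = R.x<y⇒0<y-x p
    q′ = R.x<y⇒0<y-x q

  ∣∣<-* : ∀ {z w r s} → ∣ z ∣< r → ∣ w ∣< s → ∣ z * w ∣< (r R.* s)
  ∣∣<-* {z} {w} {r} {s} (0<r , p) (0<s , q) = R.*-pos 0<r 0<s , (begin-strict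
    normSq (z * w)               ≈⟨ normSq-* z w ⟩
    normSq z R.* normSq w        ≤⟨ R.*-monoˡ-≤ (normSq-nonneg z) (R.<⇒≤ q) ⟩
    normSq z R.* (s R.* s)       ≈⟨ R.*-comm _ _ ⟩
    (s R.* s) R.* normSq z       <⟨ R.*-monoˡ-< (R.*-pos 0<s 0<s) p ⟩
    (s R.* s) R.* (r R.* r)      ≈⟨ solve 2 (λ r s → (s :* s) :* (r :* r) := (r :* s) :* (r :* s)) R.refl r s ⟩
    (r R.* s) R.* (r R.* s)      ∎)
    where open R.≤-Reasoning

  ∃-∣∣< : ∀ z → ∃[ r ] ∣ z ∣< r
  ∃-∣∣< z = n R.+ R.1# , R.+-nonneg-pos (normSq-nonneg z) R.0<1 ,
    R.difference⁺ (n R.* n R.+ n R.+ R.1#)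
      (R.+-nonneg-pos (R.+-nonneg (R.square-nonneg n) (normSq-nonneg z)) R.0<1)
      (solve 1 (λ n → (n :+ con (+ 1)) :* (n :+ con (+ 1))
                      := n :+ (n :* n :+ n :+ con (+ 1))) R.refl n)
    where n = normSq z

  -- The usable form of |z| ≥ r > 0: any r with r² ≤ |z|² will do.
  ∃-≮∣∣ : ∀ {z} → z ≉ 0# → ∃[ r ] R.0# R.< r × ¬ ∣ z ∣< r
  ∃-≮∣∣ z≉0 with R.∃-square≤ (normSq-pos z≉0)
  ... | r , 0<r , r²≤n = r , 0<r , λ (_ , p) → R.≤⇒≯ r²≤n p

  ∣∣<-null : ∀ {z} → (∀ ε → R.0# R.< ε → ∣ z ∣< ε) → z ≈ 0#
  ∣∣<-null {z} small with z ≟ 0#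
  ... | yes z≈0 = z≈0
  ... | no  z≉0 with ∃-≮∣∣ z≉0
  ...   | r , 0<r , ≮r = contradiction (small r 0<r) ≮r

  -- The bound is 2/r and not 1/r because the predicate is strict while |z| = r is allowed. The
  -- proof compares r²|1/z|² ≤ |z|²|1/z|² = 1 with r²(2/r)² = 4.
  ∣⁻¹∣< : ∀ {z r} → R.0# R.< r → z ≉ 0# → ¬ ∣ z ∣< r → ∣ z ⁻¹ ∣< (r R.⁻¹ R.+ r R.⁻¹)
  ∣⁻¹∣< {z} {r} 0<r z≉0 ≮r = R.+-pos 0<r⁻¹ 0<r⁻¹ , R.*-cancelˡ-< (R.*-pos 0<r 0<r) (begin-strict
    (r R.* r) R.* normSq (z ⁻¹)   ≈⟨ R.*-comm _ _ ⟩
    normSq (z ⁻¹) R.* (r R.* r)   ≤⟨ R.*-monoˡ-≤ (normSq-nonneg (z ⁻¹)) r²≤n ⟩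
    normSq (z ⁻¹) R.* normSq z    ≈⟨ R.*-comm _ _ ⟩
    normSq z R.* normSq (z ⁻¹)    ≈⟨ normSq-* z (z ⁻¹) ⟨
    normSq (z * z ⁻¹)             ≈⟨ normSq-cong (⁻¹-inverseʳ z≉0) ⟩
    normSq 1#                     ≈⟨ normSq-1 ⟩
    R.1#                          <⟨ R.difference⁺ _ (R.+-pos R.0<2 R.0<1)
                                      (solve 0 ((con (+ 1) :+ con (+ 1)) :* (con (+ 1) :+ con (+ 1))
                                        := con (+ 1) :+ ((con (+ 1) :+ con (+ 1)) :+ con (+ 1))) R.refl) ⟩
    (R.1# R.+ R.1#) R.* (R.1# R.+ R.1#)
                                  ≈⟨ R.*-cong (R.+-cong rr⁻¹ rr⁻¹) (R.+-cong rr⁻¹ rr⁻¹) ⟨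
    (r R.* r⁻¹ R.+ r R.* r⁻¹) R.* (r R.* r⁻¹ R.+ r R.* r⁻¹)
                                  ≈⟨ solve 2 (λ r s → (r :* s :+ r :* s) :* (r :* s :+ r :* s)
                                      := (r :* r) :* ((s :+ s) :* (s :+ s))) R.refl r r⁻¹ ⟩
    (r R.* r) R.* ((r⁻¹ R.+ r⁻¹) R.* (r⁻¹ R.+ r⁻¹)) ∎)
    where
    open R.≤-Reasoning
    r⁻¹   = r R.⁻¹
    0<r⁻¹ = R.⁻¹-pos 0<r
    rr⁻¹ : r R.* r⁻¹ R.≈ R.1#
    rr⁻¹ = R.⁻¹-inverseʳ (R.pos⇒≉0 0<r)
    r²≤n : r R.* r ≤ normSq z
    r²≤n with R.≤-<-connex (r R.* r) (normSq z)
    ... | inj₁ p = p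
    ... | inj₂ p = contradiction (0<r , p) ≮r

  -- Keeps punctured discs inhabited, on which uniqueness of limits rests. The witness is the real
  -- number ρ/2.
  ∃-nonzero-∣∣< : ∀ {ρ} → R.0# R.< ρ → ∃[ d ] d ≉ 0# × ∣ d ∣< ρ
  ∃-nonzero-∣∣< {ρ} 0<ρ with R.∃-half 0<ρ
  ... | δ , 0<δ , δ+δ≈ρ = δ +i R.0# , (λ (δ≈0 , _) → R.pos⇒≉0 0<δ δ≈0) , 0<ρ , (begin-strict
    δ R.* δ R.+ R.0# R.* R.0#    <⟨ R.difference⁺ (δ R.* δ R.+ (δ R.* δ R.+ δ R.* δ))
                                     (R.+-pos 0<δ² (R.+-pos 0<δ² 0<δ²))
                                     (solve 1 (λ d → (d :+ d) :* (d :+ d)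
                                       := d :* d :+ con (+ 0) :* con (+ 0) :+ (d :* d :+ (d :* d :+ d :* d))) R.refl δ) ⟩
    (δ R.+ δ) R.* (δ R.+ δ)      ≈⟨ R.*-cong δ+δ≈ρ δ+δ≈ρ ⟩
    ρ R.* ρ                      ∎)
    where
    open R.≤-Reasoning
    0<δ² = R.*-pos 0<δ 0<δ

-- The analysis is carried out over an abstract normed field: unfolding the
-- arithmetic of ℂ into real and imaginary parts is exponentially expensive.
record NormedField {c ℓ₁ ℓ₂} (ℝ : CompleteOrderedField c ℓ₁ ℓ₂) : Set (lsuc (c ⊔ ℓ₁ ⊔ ℓ₂)) where
  private module R = Reals ℝ
  field
    commutativeRing : CommutativeRing c ℓ₁

  open CommutativeRing commutativeRing public
  open RawSemiringDefs (CommutativeSemiring.rawSemiring commutativeSemiring) public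
    using (_^_; sum; product) renaming (_×_ to _·_)

  infix 4 _≟_ ∣_∣<_
  infix 9 _⁻¹
  infixl 7 _/_

  field
    _≟_           : Decidable _≈_
    _⁻¹           : Carrier → Carrier
    ⁻¹-cong       : ∀ {z w} → z ≈ w → z ⁻¹ ≈ w ⁻¹
    ⁻¹-inverseʳ   : ∀ {z} → z ≉ 0# → z * z ⁻¹ ≈ 1#
    ·1≉0          : ∀ n → suc n · 1# ≉ 0#
    ∣_∣<_         : Carrier → R.Carrier → Set ℓ₂
    ∣∣<⇒0<        : ∀ {z r} → ∣ z ∣< r → R.0# R.< r
    ∣∣<-cong      : ∀ {z w r s} → z ≈ w → r R.≈ s → ∣ z ∣< r → ∣ w ∣< s
    ∣∣<-weaken    : ∀ {z r s} → r R.≤ s → ∣ z ∣< r → ∣ z ∣< s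
    ∣0∣<          : ∀ {r} → R.0# R.< r → ∣ 0# ∣< r
    ∣1∣≮1         : ¬ ∣ 1# ∣< R.1#
    ∣∣<-neg       : ∀ {z r} → ∣ z ∣< r → ∣ - z ∣< r
    ∣∣<-+         : ∀ {z w r s} → ∣ z ∣< r → ∣ w ∣< s → ∣ z + w ∣< (r R.+ s)
    ∣∣<-*         : ∀ {z w r s} → ∣ z ∣< r → ∣ w ∣< s → ∣ z * w ∣< (r R.* s)
    ∃-∣∣<         : ∀ z → ∃[ r ] ∣ z ∣< r
    ∃-≮∣∣         : ∀ {z} → z ≉ 0# → ∃[ r ] R.0# R.< r × ¬ ∣ z ∣< r
    ∃-nonzero-∣∣< : ∀ {r} → R.0# R.< r → ∃[ d ] d ≉ 0# × ∣ d ∣< r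
    ∣⁻¹∣<         : ∀ {z r} → R.0# R.< r → z ≉ 0# → ¬ ∣ z ∣< r → ∣ z ⁻¹ ∣< (r R.⁻¹ R.+ r R.⁻¹)
    ^-vanishes    : ∀ {z} → ∣ z ∣< R.1# → ∀ ε → R.0# R.< ε → ∃[ N ] ∀ n → N ℕ.≤ n → ∣ z ^ n ∣< ε
    ∣^∣<1⇒∣∣<1    : ∀ {z} n → ∣ z ^ n ∣< R.1# → ∣ z ∣< R.1#

  _/_ : Carrier → Carrier → Carrier
  z / w = z * w ⁻¹

-- Limits over a normed field.

module Limits {c ℓ₁ ℓ₂} {ℝ : CompleteOrderedField c ℓ₁ ℓ₂} (K : NormedField ℝ) where
  open NormedField K
  private module R = Reals ℝ
  open IntegerSolver commutativeRing
  open Relation.Binary.Reasoning.Setoid setoid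

  1≉0 : 1# ≉ 0#
  1≉0 1≈0 = ∣1∣≮1 (∣∣<-cong (sym 1≈0) R.refl (∣0∣< R.0<1))

  ≉-resp : ∀ {z w} → z ≈ w → w ≉ 0# → z ≉ 0#
  ≉-resp z≈w w≉0 z≈0 = w≉0 (trans (sym z≈w) z≈0)

  *-cancelˡ : ∀ {z x y} → z ≉ 0# → z * x ≈ z * y → x ≈ y
  *-cancelˡ {z} {x} {y} z≉0 zx≈zy = begin
    x               ≈⟨ *-identityˡ x ⟨
    1# * x          ≈⟨ *-congʳ (⁻¹-inverseʳ z≉0) ⟨
    (z * z ⁻¹) * x  ≈⟨ shuffle x ⟩
    z ⁻¹ * (z * x)  ≈⟨ *-congˡ zx≈zy ⟩
    z ⁻¹ * (z * y)  ≈⟨ shuffle y ⟨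
    (z * z ⁻¹) * y  ≈⟨ *-congʳ (⁻¹-inverseʳ z≉0) ⟩
    1# * y          ≈⟨ *-identityˡ y ⟩
    y               ∎
    where
    shuffle : ∀ x → (z * z ⁻¹) * x ≈ z ⁻¹ * (z * x)
    shuffle = solve 3 (λ z z⁻¹ x → (z :* z⁻¹) :* x := z⁻¹ :* (z :* x)) refl z (z ⁻¹)

  *-≉0 : ∀ {z w} → z ≉ 0# → w ≉ 0# → z * w ≉ 0#
  *-≉0 z≉0 w≉0 zw≈0 = w≉0 (*-cancelˡ z≉0 (trans zw≈0 (sym (zeroʳ _))))

  *-≉0ˡ : ∀ {z w} → z * w ≉ 0# → z ≉ 0#
  *-≉0ˡ zw≉0 z≈0 = zw≉0 (trans (*-congʳ z≈0) (zeroˡ _))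

  *-≉0ʳ : ∀ {z w} → z * w ≉ 0# → w ≉ 0#
  *-≉0ʳ zw≉0 w≈0 = zw≉0 (trans (*-congˡ w≈0) (zeroʳ _))

  ⁻¹-unique : ∀ {z w} → z * w ≈ 1# → w ≈ z ⁻¹
  ⁻¹-unique zw≈1 = *-cancelˡ z≉0 (trans zw≈1 (sym (⁻¹-inverseʳ z≉0)))
    where z≉0 = *-≉0ˡ (≉-resp zw≈1 1≉0)

  x-y≈0⇒x≈y : ∀ {x y} → x - y ≈ 0# → x ≈ y
  x-y≈0⇒x≈y {x} {y} x-y≈0 = begin
    x            ≈⟨ solve 2 (λ x y → x := (x :- y) :+ y) refl x y ⟩
    (x - y) + y  ≈⟨ +-congʳ x-y≈0 ⟩
    0# + y       ≈⟨ +-identityˡ y ⟩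
    y            ∎

  x≈y⇒x-y≈0 : ∀ {x y} → x ≈ y → x - y ≈ 0#
  x≈y⇒x-y≈0 x≈y = trans (+-congʳ x≈y) (-‿inverseʳ _)

  ≉⇒-≉0 : ∀ {x y} → x ≉ y → x - y ≉ 0#
  ≉⇒-≉0 x≉y = x≉y ∘ x-y≈0⇒x≈y

  -- Drives the limit and the derivative of an inverse, and later the splitting of 1/Q into its
  -- value at w and a multiple of z - w.
  ⁻¹-difference : ∀ {z w} → z ≉ 0# → w ≉ 0# → z ⁻¹ - w ⁻¹ ≈ - (z - w) * (z ⁻¹ * w ⁻¹)
  ⁻¹-difference {z} {w} z≉0 w≉0 = begin
    z ⁻¹ - w ⁻¹                            ≈⟨ +-cong (*-identityʳ _) (-‿cong (*-identityˡ _)) ⟨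
    z ⁻¹ * 1# - 1# * w ⁻¹                  ≈⟨ +-cong (*-congˡ (⁻¹-inverseʳ w≉0)) (-‿cong (*-congʳ (⁻¹-inverseʳ z≉0))) ⟨
    z ⁻¹ * (w * w ⁻¹) - (z * z ⁻¹) * w ⁻¹  ≈⟨ solve 4 (λ z w u v → u :* (w :* v) :- (z :* u) :* v
                                                 := :- (z :- w) :* (u :* v)) refl z w (z ⁻¹) (w ⁻¹) ⟩
    - (z - w) * (z ⁻¹ * w ⁻¹)              ∎

  ∣∣<-null : ∀ {z} → (∀ ε → R.0# R.< ε → ∣ z ∣< ε) → z ≈ 0#
  ∣∣<-null {z} small with z ≟ 0#
  ... | yes z≈0 = z≈0
  ... | no  z≉0 with ∃-≮∣∣ z≉0
  ...   | r , 0<r , ≮r = contradiction (small r 0<r) ≮r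

  -- These repeat the shape of the definitions used in the theorem, so at ℂ the two versions agree
  -- by computation.
  Near Near≠ : ∀ {ℓ} → Carrier → (Carrier → Set ℓ) → Set _
  Near  w P = ∃[ ρ ] (R.0# R.< ρ) × (∀ z → ∣ z - w ∣< ρ → P z)
  Near≠ w P = Near w (λ z → z ≉ w → P z)

  LimitAt : (Carrier → Carrier) → Carrier → Carrier → Set (c ⊔ ℓ₁ ⊔ ℓ₂)
  LimitAt g w l = ∀ ε → R.0# R.< ε → Near≠ w (λ z → ∣ g z - l ∣< ε)

  module _ {p q s} {P : Carrier → Set p} {Q : Carrier → Set q} {S : Carrier → Set s} {w : Carrier} where

    Near-zip : (∀ z → P z → Q z → S z) → Near w P → Near w Q → Near w S
    Near-zip f (ρ , 0<ρ , P-near) (σ , 0<σ , Q-near) with R.∃-min 0<ρ 0<σ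
    ... | τ , 0<τ , τ≤ρ , τ≤σ = τ , 0<τ , λ z z-near →
      f z (P-near z (∣∣<-weaken τ≤ρ z-near)) (Q-near z (∣∣<-weaken τ≤σ z-near))

  module _ {p q} {P : Carrier → Set p} {Q : Carrier → Set q} {w : Carrier} where

    Near-map : (∀ z → P z → Q z) → Near w P → Near w Q
    Near-map f (ρ , 0<ρ , P-near) = ρ , 0<ρ , λ z → f z ∘ P-near z

  Near-all : ∀ {p} {P : Carrier → Set p} {w} → (∀ z → P z) → Near w P
  Near-all f = R.1# , R.0<1 , λ z _ → f z

  Near-centre : ∀ {p} {P : Carrier → Set p} {w} → Near w P → P w
  Near-centre (ρ , 0<ρ , P-near) = P-near _ (∣∣<-cong (sym (-‿inverseʳ _)) R.refl (∣0∣< 0<ρ))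

  Near≠-point : ∀ {p} {P : Carrier → Set p} {w} → Near≠ w P → ∃[ z ] (z ≉ w) × P z
  Near≠-point {w = w} (ρ , 0<ρ , P-near) with ∃-nonzero-∣∣< 0<ρ
  ... | d , d≉0 , ∣d∣<ρ = w + d , w+d≉w , P-near (w + d) (∣∣<-cong (sym w+d-w≈d) R.refl ∣d∣<ρ) w+d≉w
    where
    w+d-w≈d : (w + d) - w ≈ d
    w+d-w≈d = solve 2 (λ w d → (w :+ d) :- w := d) refl w d
    w+d≉w : w + d ≉ w
    w+d≉w e = d≉0 (trans (sym w+d-w≈d) (x≈y⇒x-y≈0 e))

  -- LimitAt unfolds; wrapping it keeps f, w and l inferable.
  record Lim (f : Carrier → Carrier) (w l : Carrier) : Set (c ⊔ ℓ₁ ⊔ ℓ₂) where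
    constructor lim
    field limitAt : LimitAt f w l
  open Lim public

  private variable
    f g : Carrier → Carrier
    v w l m : Carrier

  Lim-cong : Near≠ w (λ z → f z ≈ g z) → l ≈ m → Lim f w l → Lim g w m
  Lim-cong f≈g l≈m (lim f→l) = lim λ ε 0<ε → Near-zip
    (λ z f≈g f-l z≉w → ∣∣<-cong (+-cong (f≈g z≉w) (-‿cong l≈m)) R.refl (f-l z≉w)) f≈g (f→l ε 0<ε)

  Lim-≗ : (∀ z → f z ≈ g z) → l ≈ m → Lim f w l → Lim g w m
  Lim-≗ f≈g = Lim-cong (Near-all λ z _ → f≈g z)

  Lim-const : ∀ x → Lim (λ _ → x) w x
  Lim-const x = lim λ ε 0<ε → Near-all λ z _ → ∣∣<-cong (sym (-‿inverseʳ x)) R.refl (∣0∣< 0<ε)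

  Lim-id : Lim (λ z → z) w w
  Lim-id = lim λ ε 0<ε → ε , 0<ε , λ z z-near _ → z-near

  Lim-+ : Lim f w l → Lim g w m → Lim (λ z → f z + g z) w (l + m)
  Lim-+ {f} {l = l} {g} {m} (lim f→l) (lim g→m) = lim λ ε 0<ε →
    let h , 0<h , h+h≈ε = R.∃-half 0<ε in
    Near-zip (λ z f-l g-m z≉w → ∣∣<-cong
        (solve 4 (λ f g l m → (f :- l) :+ (g :- m) := (f :+ g) :- (l :+ m)) refl (f z) (g z) l m)
        h+h≈ε (∣∣<-+ (f-l z≉w) (g-m z≉w)))
      (f→l h 0<h) (g→m h 0<h)

  Lim-neg : Lim f w l → Lim (λ z → - f z) w (- l)
  Lim-neg {f} {l = l} (lim f→l) = lim λ ε 0<ε → Near-map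
    (λ z f-l z≉w → ∣∣<-cong (solve 2 (λ f l → :- (f :- l) := :- f :- :- l) refl (f z) l) R.refl
      (∣∣<-neg (f-l z≉w)))
    (f→l ε 0<ε)

  Lim⇒bounded : Lim f w l → ∃[ M ] (R.0# R.< M) × Near≠ w (λ z → ∣ f z ∣< M)
  Lim⇒bounded {f} {l = l} (lim f→l) with ∃-∣∣< l
  ... | r , ∣l∣<r = R.1# R.+ r , R.+-pos R.0<1 (∣∣<⇒0< ∣l∣<r) , Near-map
    (λ z f-l z≉w → ∣∣<-cong (solve 2 (λ f l → (f :- l) :+ l := f) refl (f z) l) R.refl
      (∣∣<-+ (f-l z≉w) ∣l∣<r))
    (f→l R.1# R.0<1)

  -- Splits fg - lm as f(g - m) + m(f - l). With |f| < M near w and |m| < K, the tolerances ε/(2M)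
  -- for g and ε/(2K) for f give each term half of ε.
  Lim-* : Lim f w l → Lim g w m → Lim (λ z → f z * g z) w (l * m)
  Lim-* {f} {l = l} {g} {m} F@(lim f→l) (lim g→m) with Lim⇒bounded F | ∃-∣∣< m
  ... | M , 0<M , f-bounded | K , ∣m∣<K = lim λ ε 0<ε →
    let h , 0<h , h+h≈ε = R.∃-half 0<ε
        δ , 0<δ , Mδ≈h  = R.∃-quotient 0<h 0<M
        η , 0<η , Kη≈h  = R.∃-quotient 0<h (∣∣<⇒0< ∣m∣<K)
    in Near-zip (λ z (f<M , f-l) g-m z≉w → ∣∣<-cong
        (solve 4 (λ f g l m → f :* (g :- m) :+ m :* (f :- l) := f :* g :- l :* m) refl (f z) (g z) l m)
        (R.trans (R.+-cong Mδ≈h Kη≈h) h+h≈ε)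
        (∣∣<-+ (∣∣<-* (f<M z≉w) (g-m z≉w)) (∣∣<-* ∣m∣<K (f-l z≉w))))
      (Near-zip (λ _ → _,_) f-bounded (f→l η 0<η)) (g→m δ 0<δ)

  -- If |l| is not below r and f z is within r/2 of l, then |f z| < r/2 would force |l| < r.
  Lim⇒away-from-0 : l ≉ 0# → Lim f w l →
    ∃[ r ] (R.0# R.< r) × Near≠ w (λ z → f z ≉ 0# × ¬ ∣ f z ∣< r)
  Lim⇒away-from-0 {l} {f} {w} l≉0 (lim f→l) with ∃-≮∣∣ l≉0
  ... | r , 0<r , ≮r with R.∃-half 0<r
  ...   | h , 0<h , h+h≈r = h , 0<h , Near-map away (f→l h 0<h)
    where
    away : ∀ z → (z ≉ w → ∣ f z - l ∣< h) → z ≉ w → f z ≉ 0# × ¬ ∣ f z ∣< h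
    away z f-l z≉w = (λ f≈0 → ≮h (∣∣<-cong (sym f≈0) R.refl (∣0∣< 0<h))) , ≮h
      where
      ≮h : ¬ ∣ f z ∣< h
      ≮h f<h = ≮r (∣∣<-cong (solve 2 (λ f l → f :+ :- (f :- l) := l) refl (f z) l)
                 h+h≈r (∣∣<-+ f<h (∣∣<-neg (f-l z≉w))))

  Lim-≉0 : l ≉ 0# → Lim f w l → Near≠ w (λ z → f z ≉ 0#)
  Lim-≉0 l≉0 F = Near-map (λ z h z≉w → proj₁ (h z≉w)) (proj₂ (proj₂ (Lim⇒away-from-0 l≉0 F)))

  -- By `⁻¹-difference` the error is (l - f z) times 1/(f z) and 1/l. These inverses are below B =
  -- 2/r and M, so δ = ε/(BM) suffices.
  Lim-⁻¹ : l ≉ 0# → Lim f w l → Lim (λ z → f z ⁻¹) w (l ⁻¹)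
  Lim-⁻¹ {l} {f} {w} l≉0 F@(lim f→l) with Lim⇒away-from-0 l≉0 F | ∃-∣∣< (l ⁻¹)
  ... | r , 0<r , f-away | M , ∣l⁻¹∣<M = lim λ ε 0<ε →
    let δ , 0<δ , BMδ≈ε = R.∃-quotient 0<ε (R.*-pos 0<B (∣∣<⇒0< ∣l⁻¹∣<M))
    in Near-zip (close BMδ≈ε) f-away (f→l δ 0<δ)
    where
    B   = r R.⁻¹ R.+ r R.⁻¹
    0<B = R.+-pos (R.⁻¹-pos 0<r) (R.⁻¹-pos 0<r)
    close : ∀ {δ ε} → (B R.* M) R.* δ R.≈ ε → ∀ z →
      (z ≉ w → f z ≉ 0# × ¬ ∣ f z ∣< r) → (z ≉ w → ∣ f z - l ∣< δ) →
      z ≉ w → ∣ f z ⁻¹ - l ⁻¹ ∣< ε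
    close BMδ≈ε z f-away f-l z≉w with f-away z≉w
    ... | f≉0 , ≮r = ∣∣<-cong (trans (*-comm _ _) (sym (⁻¹-difference f≉0 l≉0))) BMδ≈ε
      (∣∣<-* (∣∣<-* (∣⁻¹∣< 0<r f≉0 ≮r) ∣l⁻¹∣<M) (∣∣<-neg (f-l z≉w)))

  Lim-unique : Lim f w l → Lim f w m → l ≈ m
  Lim-unique {f} {w} {l} {m} (lim f→l) (lim f→m) = x-y≈0⇒x≈y (∣∣<-null λ ε 0<ε →
    let h , 0<h , h+h≈ε = R.∃-half 0<ε
        z , z≉w , p , q = Near≠-point (Near-zip (λ z p q z≉w → p z≉w , q z≉w) (f→l h 0<h) (f→m h 0<h))
    in ∣∣<-cong (solve 3 (λ f l m → :- (f :- l) :+ (f :- m) := l :- m) refl (f z) l m) h+h≈ε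
         (∣∣<-+ (∣∣<-neg p) q))

  -- Derivatives.

  record Deriv (f : Carrier → Carrier) (w f′ : Carrier) : Set (c ⊔ ℓ₁ ⊔ ℓ₂) where
    constructor deriv
    field difference-quotient : Lim (λ z → (f z - f w) / (z - w)) w f′
  open Deriv public

  private variable
    f′ g′ : Carrier

  Deriv-≗ : (∀ z → f z ≈ g z) → f′ ≈ g′ → Deriv f w f′ → Deriv g w g′
  Deriv-≗ f≈g f′≈g′ (deriv df) =
    deriv (Lim-≗ (λ z → *-congʳ (+-cong (f≈g z) (-‿cong (f≈g _)))) f′≈g′ df)

  Deriv-unique : Deriv f w f′ → Deriv f w g′ → f′ ≈ g′
  Deriv-unique (deriv df) (deriv dg) = Lim-unique df dg

  Deriv⇒Lim : Deriv f w f′ → Lim f w (f w)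
  Deriv⇒Lim {f} {w} {f′} (deriv df) = Lim-cong
    (Near-all λ z z≉w → begin
      f w + ((f z - f w) / (z - w)) * (z - w)      ≈⟨ +-congˡ (solve 3 (λ x u v → (x :* v) :* u := x :* (u :* v)) refl _ _ _) ⟩
      f w + (f z - f w) * ((z - w) * (z - w) ⁻¹)   ≈⟨ +-congˡ (*-congˡ (⁻¹-inverseʳ (≉⇒-≉0 z≉w))) ⟩
      f w + (f z - f w) * 1#                       ≈⟨ solve 2 (λ a b → a :+ (b :- a) :* con (+ 1) := b) refl (f w) (f z) ⟩
      f z                                          ∎)
    (solve 3 (λ a b w → a :+ b :* (w :- w) := a) refl (f w) f′ w)
    (Lim-+ (Lim-const (f w)) (Lim-* df (Lim-+ Lim-id (Lim-neg (Lim-const w)))))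

  Deriv-const : ∀ x → Deriv (λ _ → x) w 0#
  Deriv-const x = deriv (Lim-≗ (λ z → sym (trans (*-congʳ (-‿inverseʳ x)) (zeroˡ _))) refl (Lim-const 0#))

  Deriv-id : Deriv (λ z → z) w 1#
  Deriv-id = deriv (Lim-cong (Near-all λ z z≉w → sym (⁻¹-inverseʳ (≉⇒-≉0 z≉w))) refl (Lim-const 1#))

  Deriv-+ : Deriv f w f′ → Deriv g w g′ → Deriv (λ z → f z + g z) w (f′ + g′)
  Deriv-+ {f} {w} {g = g} (deriv df) (deriv dg) = deriv (Lim-≗
    (λ z → solve 5 (λ a b c d u → (a :- b) :* u :+ (c :- d) :* u := ((a :+ c) :- (b :+ d)) :* u)
      refl (f z) (f w) (g z) (g w) ((z - w) ⁻¹))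
    refl (Lim-+ df dg))

  Deriv-neg : Deriv f w f′ → Deriv (λ z → - f z) w (- f′)
  Deriv-neg {f} {w} (deriv df) = deriv (Lim-≗
    (λ z → solve 3 (λ a b u → :- ((a :- b) :* u) := (:- a :- :- b) :* u) refl (f z) (f w) ((z - w) ⁻¹))
    refl (Lim-neg df))

  -- The difference quotient splits as (quotient of f) · g z + f w · (quotient of g), so continuity
  -- of g at w is needed besides the two derivatives.
  Deriv-* : Deriv f w f′ → Deriv g w g′ → Deriv (λ z → f z * g z) w (f′ * g w + f w * g′)
  Deriv-* {f} {w} {g = g} (deriv df) dg = deriv (Lim-≗
    (λ z → solve 5 (λ a b c d u → ((a :- b) :* u) :* c :+ b :* ((c :- d) :* u) := (a :* c :- b :* d) :* u)
      refl (f z) (f w) (g z) (g w) ((z - w) ⁻¹))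
    refl (Lim-+ (Lim-* df (Deriv⇒Lim dg)) (Lim-* (Lim-const (f w)) (difference-quotient dg))))

  Deriv-⁻¹ : f w ≉ 0# → Deriv f w f′ → Deriv (λ z → f z ⁻¹) w (- (f′ * (f w ⁻¹ * f w ⁻¹)))
  Deriv-⁻¹ {f} {w} fw≉0 df = deriv (Lim-cong
    (Near-map (λ z fz≉0 z≉w → begin
        - (((f z - f w) * (z - w) ⁻¹) * (f z ⁻¹ * f w ⁻¹))  ≈⟨ solve 3 (λ d u v → :- ((d :* u) :* v) := (:- d :* v) :* u) refl _ _ _ ⟩
        (- (f z - f w) * (f z ⁻¹ * f w ⁻¹)) * (z - w) ⁻¹    ≈⟨ *-congʳ (⁻¹-difference (fz≉0 z≉w) fw≉0) ⟨
        (f z ⁻¹ - f w ⁻¹) * (z - w) ⁻¹                      ∎)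
      (Lim-≉0 fw≉0 (Deriv⇒Lim df)))
    refl
    (Lim-neg (Lim-* (difference-quotient df) (Lim-* (Lim-⁻¹ fw≉0 (Deriv⇒Lim df)) (Lim-const (f w ⁻¹))))))

-- Holomorphic functions, division of polynomials, and simple poles.

module Holomorphy {c ℓ₁ ℓ₂} {ℝ : CompleteOrderedField c ℓ₁ ℓ₂} (K : NormedField ℝ) where
  open NormedField K
  open Limits K
  open IntegerSolver commutativeRing
  open Relation.Binary.Reasoning.Setoid setoid
  open Algebra.Properties.Semiring.Exp semiring using (^-congˡ)
  open Algebra.Properties.CommutativeSemiring.Exp commutativeSemiring using (^-distrib-*)

  private variable
    f g : Carrier → Carrier
    w b d : Carrier

  -- Equality is a setoid relation, which a bare function may fail to respect; a regular part must
  -- respect it to become a `Function`.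
  Congruent : (Carrier → Carrier) → Set (c ⊔ ℓ₁)
  Congruent f = ∀ {x y} → x ≈ y → f x ≈ f y

  Differentiable : (Carrier → Carrier) → Carrier → Set (c ⊔ ℓ₁ ⊔ ℓ₂)
  Differentiable f w = ∃[ f′ ] Deriv f w f′

  Differentiable-+ : Differentiable f w → Differentiable g w → Differentiable (λ z → f z + g z) w
  Differentiable-+ (_ , df) (_ , dg) = _ , Deriv-+ df dg

  Differentiable-neg : Differentiable f w → Differentiable (λ z → - f z) w
  Differentiable-neg (_ , df) = _ , Deriv-neg df

  Differentiable-* : Differentiable f w → Differentiable g w → Differentiable (λ z → f z * g z) w
  Differentiable-* (_ , df) (_ , dg) = _ , Deriv-* df dg

  Differentiable-⁻¹ : f w ≉ 0# → Differentiable f w → Differentiable (λ z → f z ⁻¹) w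
  Differentiable-⁻¹ fw≉0 (_ , df) = _ , Deriv-⁻¹ fw≉0 df

  record Holomorphic (f : Carrier → Carrier) (w : Carrier) : Set (c ⊔ ℓ₁ ⊔ ℓ₂) where
    constructor holomorphic
    field near : Near w (Differentiable f)
  open Holomorphic public

  Holomorphic-const : ∀ x → Holomorphic (λ _ → x) w
  Holomorphic-const x = holomorphic (Near-all λ _ → _ , Deriv-const x)

  Holomorphic-id : Holomorphic (λ z → z) w
  Holomorphic-id = holomorphic (Near-all λ _ → _ , Deriv-id)

  Holomorphic-+ : Holomorphic f w → Holomorphic g w → Holomorphic (λ z → f z + g z) w
  Holomorphic-+ (holomorphic F) (holomorphic G) =
    holomorphic (Near-zip (λ _ → Differentiable-+) F G)

  Holomorphic-neg : Holomorphic f w → Holomorphic (λ z → - f z) w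
  Holomorphic-neg (holomorphic F) = holomorphic (Near-map (λ _ → Differentiable-neg) F)

  Holomorphic-* : Holomorphic f w → Holomorphic g w → Holomorphic (λ z → f z * g z) w
  Holomorphic-* (holomorphic F) (holomorphic G) =
    holomorphic (Near-zip (λ _ → Differentiable-*) F G)

  Differentiable⇒Lim : Differentiable f w → Lim f w (f w)
  Differentiable⇒Lim (_ , df) = Deriv⇒Lim df

  -- A limit says nothing at points equal to w; there the value is controlled by congruence and f w
  -- ≉ 0.
  Near-≉0 : Congruent f → f w ≉ 0# → Lim f w (f w) → Near w (λ z → f z ≉ 0#)
  Near-≉0 {f} {w} f-cong fw≉0 F = Near-map away (Lim-≉0 fw≉0 F)
    where
    away : ∀ z → (z ≉ w → f z ≉ 0#) → f z ≉ 0#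
    away z fz≉0 with z ≟ w
    ... | yes z≈w = ≉-resp (f-cong z≈w) fw≉0
    ... | no  z≉w = fz≉0 z≉w

  Holomorphic-⁻¹ : Congruent f → f w ≉ 0# → Holomorphic f w → Holomorphic (λ z → f z ⁻¹) w
  Holomorphic-⁻¹ f-cong fw≉0 (holomorphic F) = holomorphic (Near-zip
    (λ _ → Differentiable-⁻¹) (Near-≉0 f-cong fw≉0 (Differentiable⇒Lim (Near-centre F))) F)

  Holomorphic-^ : ∀ n → Holomorphic (_^ n) w
  Holomorphic-^ zero    = Holomorphic-const 1#
  Holomorphic-^ (suc n) = Holomorphic-* Holomorphic-id (Holomorphic-^ n)

  -- Coefficient lists keep the quotient by t - w a polynomial, so that it can be divided again and
  -- is visibly holomorphic.
  eval : List Carrier → Carrier → Carrier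
  eval f t = foldr (λ a b → a + t * b) 0# f

  eval-cong : ∀ f → Congruent (eval f)
  eval-cong []      _   = refl
  eval-cong (a ∷ f) x≈y = +-congˡ (*-cong x≈y (eval-cong f x≈y))

  Holomorphic-eval : ∀ f → Holomorphic (eval f) w
  Holomorphic-eval []      = Holomorphic-const 0#
  Holomorphic-eval (a ∷ f) =
    Holomorphic-+ (Holomorphic-const a) (Holomorphic-* Holomorphic-id (Holomorphic-eval f))

  -- The quotient of f - f(w) by t - w, by Horner's scheme.
  quotient : List Carrier → Carrier → List Carrier
  quotient []      w = []
  quotient (a ∷ f) w = eval f w ∷ quotient f w

  eval-quotient : ∀ f w z → eval f z - eval f w ≈ (z - w) * eval (quotient f w) z
  eval-quotient [] w z =
    solve 2 (λ z w → con (+ 0) :- con (+ 0) := (z :- w) :* con (+ 0)) refl z w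
  eval-quotient (a ∷ f) w z = begin
    (a + z * F) - (a + w * F′)          ≈⟨ solve 5 (λ a z w F F′ → (a :+ z :* F) :- (a :+ w :* F′)
                                            := (z :- w) :* F′ :+ z :* (F :- F′)) refl a z w F F′ ⟩
    (z - w) * F′ + z * (F - F′)         ≈⟨ +-congˡ (*-congˡ (eval-quotient f w z)) ⟩
    (z - w) * F′ + z * ((z - w) * q)    ≈⟨ solve 4 (λ z u F′ q → u :* F′ :+ z :* (u :* q)
                                            := u :* (F′ :+ z :* q)) refl z (z - w) F′ q ⟩
    (z - w) * (F′ + z * q)              ∎
    where
    F  = eval f z
    F′ = eval f w
    q  = eval (quotient f w) z

  monomial : ℕ → List Carrier
  monomial zero    = 1# ∷ []
  monomial (suc n) = 0# ∷ monomial n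

  eval-monomial : ∀ n z → eval (monomial n) z ≈ z ^ n
  eval-monomial zero    z = trans (+-congˡ (zeroʳ z)) (+-identityʳ 1#)
  eval-monomial (suc n) z = trans (+-identityˡ _) (*-congˡ (eval-monomial n z))

  -- At t = w the quotient of t^(n+1) - w^(n+1) by t - w is the derivative of t^(n+1). The Horner
  -- recursion reproduces the product rule for t · t^n.
  monomial-derivative : ∀ n w → eval (quotient (monomial (suc n)) w) w ≈ suc n · 1# * w ^ n
  monomial-derivative zero w =
    solve 1 (λ w → (con (+ 1) :+ w :* con (+ 0)) :+ w :* (con (+ 0) :+ w :* con (+ 0))
      := (con (+ 1) :+ con (+ 0)) :* con (+ 1)) refl w
  monomial-derivative (suc n) w = begin
    eval (monomial (suc n)) w + w * eval (quotient (monomial (suc n)) w) w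
      ≈⟨ +-cong (eval-monomial (suc n) w) (*-congˡ (monomial-derivative n w)) ⟩
    w * w ^ n + w * (suc n · 1# * w ^ n)
      ≈⟨ solve 3 (λ w X N → w :* X :+ w :* (N :* X) := (con (+ 1) :+ N) :* (w :* X)) refl w (w ^ n) (suc n · 1#) ⟩
    suc (suc n) · 1# * (w * w ^ n) ∎

  1^n≈1 : ∀ n → 1# ^ n ≈ 1#
  1^n≈1 zero    = refl
  1^n≈1 (suc n) = trans (*-identityˡ _) (1^n≈1 n)

  ^-inverse : ∀ {x y} n → x * y ≈ 1# → x ^ n * y ^ n ≈ 1#
  ^-inverse {x} {y} n xy≈1 = begin
    x ^ n * y ^ n  ≈⟨ ^-distrib-* x y n ⟨
    (x * y) ^ n    ≈⟨ ^-congˡ n xy≈1 ⟩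
    1# ^ n         ≈⟨ 1^n≈1 n ⟩
    1#             ∎

  -- The principal part of f at w is b / (z - w); w is no pole if b ≈ 0.
  record SimplePart (f : Carrier → Carrier) (w b : Carrier) : Set (c ⊔ ℓ₁ ⊔ ℓ₂) where
    field
      regular             : Carrier → Carrier
      regular-cong        : Congruent regular
      regular-holomorphic : Holomorphic regular w
      expansion           : Near≠ w (λ z → f z ≈ b / (z - w) + regular z)

  Holomorphic⇒SimplePart : Congruent f → Holomorphic f w → SimplePart f w 0#
  Holomorphic⇒SimplePart {f} f-cong F = record
    { regular             = f
    ; regular-cong        = f-cong
    ; regular-holomorphic = F
    ; expansion           = Near-all λ z _ → sym (trans (+-congʳ (zeroˡ _)) (+-identityˡ _))
    }

  -- The right-hand side is what the sum in `HasPrincipalPart` with one coefficient computes to.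
  /≈/^1+0 : ∀ b u → b / u ≈ b / u ^ 1 + 0#
  /≈/^1+0 b u = trans (*-congˡ (⁻¹-cong (sym (*-identityʳ u)))) (sym (+-identityʳ _))

  SimplePart-cong : (∀ z → f z ≈ g z) → b ≈ d → SimplePart f w b → SimplePart g w d
  SimplePart-cong f≈g b≈d F = record
    { regular             = regular
    ; regular-cong        = regular-cong
    ; regular-holomorphic = regular-holomorphic
    ; expansion           = Near-map
        (λ z e z≉w → trans (sym (f≈g z)) (trans (e z≉w) (+-congʳ (*-congʳ b≈d)))) expansion
    }
    where open SimplePart F

  SimplePart-+ : SimplePart f w b → SimplePart g w d → SimplePart (λ z → f z + g z) w (b + d)
  SimplePart-+ {w = w} {b} {d = d} F G = record
    { regular             = λ z → F.regular z + G.regular z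
    ; regular-cong        = λ e → +-cong (F.regular-cong e) (G.regular-cong e)
    ; regular-holomorphic = Holomorphic-+ F.regular-holomorphic G.regular-holomorphic
    ; expansion           = Near-zip
        (λ z e e′ z≉w → trans (+-cong (e z≉w) (e′ z≉w))
          (solve 5 (λ b d u x y → (b :* u :+ x) :+ (d :* u :+ y) := (b :+ d) :* u :+ (x :+ y))
             refl b d ((z - w) ⁻¹) (F.regular z) (G.regular z)))
        F.expansion G.expansion
    }
    where
    module F = SimplePart F
    module G = SimplePart G

  SimplePart-neg : SimplePart f w b → SimplePart (λ z → - f z) w (- b)
  SimplePart-neg {w = w} {b} F = record
    { regular             = λ z → - regular z
    ; regular-cong        = λ e → -‿cong (regular-cong e)
    ; regular-holomorphic = Holomorphic-neg regular-holomorphic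
    ; expansion           = Near-map
        (λ z e z≉w → trans (-‿cong (e z≉w))
          (solve 3 (λ b u x → :- (b :* u :+ x) := :- b :* u :+ :- x) refl b ((z - w) ⁻¹) (regular z)))
        expansion
    }
    where open SimplePart F

  -- z κₙ(z) is the logarithmic derivative of tⁿ - 1 at t = 1/z.
  κ : ℕ → Carrier → Carrier
  κ n z = n · 1# / (1# - z ^ n)

  κ-cong : ∀ n → Congruent (κ n)
  κ-cong n x≈y = *-congˡ (⁻¹-cong (+-congˡ (-‿cong (^-congˡ n x≈y))))

  κ-holomorphic : ∀ n → w ^ n ≉ 1# → Holomorphic (κ n) w
  κ-holomorphic n wⁿ≉1 = Holomorphic-* (Holomorphic-const _)
    (Holomorphic-⁻¹ (λ x≈y → +-congˡ (-‿cong (^-congˡ n x≈y))) (≉⇒-≉0 (wⁿ≉1 ∘ sym))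
      (Holomorphic-+ (Holomorphic-const 1#) (Holomorphic-neg (Holomorphic-^ n))))

  module _ (k : ℕ) (wⁿ≈1 : w ^ suc k ≈ 1#) where
    private
      n  = suc k · 1#
      Q  = quotient (monomial (suc k)) w
      Q₂ = quotient Q w
      a  = eval Q w

      w≉0 : w ≉ 0#
      w≉0 = *-≉0ˡ (≉-resp wⁿ≈1 1≉0)

      a⁻¹≈ : n ⁻¹ * (w ⁻¹) ^ k ≈ a ⁻¹
      a⁻¹≈ = ⁻¹-unique (begin
        a * (n ⁻¹ * (w ⁻¹) ^ k)            ≈⟨ *-congʳ (monomial-derivative k w) ⟩
        (n * w ^ k) * (n ⁻¹ * (w ⁻¹) ^ k)  ≈⟨ solve 4 (λ n X m Y → (n :* X) :* (m :* Y) := (n :* m) :* (X :* Y))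
                                               refl n (w ^ k) (n ⁻¹) ((w ⁻¹) ^ k) ⟩
        (n * n ⁻¹) * (w ^ k * (w ⁻¹) ^ k)  ≈⟨ *-cong (⁻¹-inverseʳ (·1≉0 k)) (^-inverse k (⁻¹-inverseʳ w≉0)) ⟩
        1# * 1#                            ≈⟨ *-identityˡ 1# ⟩
        1#                                 ∎)

      a≉0 : a ≉ 0#
      a≉0 = ≉-resp (monomial-derivative k w)
        -- w^k is nonzero as a factor of w^(k+1) = 1.
        (*-≉0 (·1≉0 k) (*-≉0ʳ {w} (≉-resp wⁿ≈1 1≉0)))

      1-zⁿ : ∀ z → 1# - z ^ suc k ≈ - ((z - w) * eval Q z)
      1-zⁿ z = begin
        1# - z ^ suc k                ≈⟨ +-cong wⁿ≈1 (-‿cong (eval-monomial (suc k) z)) ⟨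
        w ^ suc k - eval M z          ≈⟨ +-congʳ (eval-monomial (suc k) w) ⟨
        eval M w - eval M z           ≈⟨ solve 2 (λ x y → x :- y := :- (y :- x)) refl (eval M w) (eval M z) ⟩
        - (eval M z - eval M w)       ≈⟨ -‿cong (eval-quotient M w z) ⟩
        - ((z - w) * eval Q z)        ∎
        where M = monomial (suc k)

      expand : ∀ z → z ≉ w → eval Q z ≉ 0# →
        κ (suc k) z ≈ - (n * a ⁻¹) / (z - w) + n * (eval Q₂ z * (eval Q z ⁻¹ * a ⁻¹))
      expand z z≉w Qz≉0 = begin
        n * (1# - z ^ suc k) ⁻¹
          ≈⟨ *-congˡ (⁻¹-unique inverse) ⟨
        n * - (u ⁻¹ * q ⁻¹)
          -- Adding and subtracting 1/a isolates the pole; the remainder contains 1/q - 1/a, which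
          -- is divisible by u and so absorbs 1/u.
          ≈⟨ solve 4 (λ n v p b → n :* :- (v :* p) := :- (n :* b) :* v :+ :- ((n :* v) :* (p :- b)))
               refl n (u ⁻¹) (q ⁻¹) (a ⁻¹) ⟩
        - (n * a ⁻¹) * u ⁻¹ + - ((n * u ⁻¹) * (q ⁻¹ - a ⁻¹))
          ≈⟨ +-congˡ (-‿cong (*-congˡ (⁻¹-difference Qz≉0 a≉0))) ⟩
        - (n * a ⁻¹) * u ⁻¹ + - ((n * u ⁻¹) * (- (q - a) * (q ⁻¹ * a ⁻¹)))
          ≈⟨ +-congˡ (-‿cong (*-congˡ (*-congʳ (-‿cong (eval-quotient Q w z))))) ⟩
        - (n * a ⁻¹) * u ⁻¹ + - ((n * u ⁻¹) * (- (u * q₂) * (q ⁻¹ * a ⁻¹)))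
          ≈⟨ +-congˡ (solve 5 (λ n u v q₂ x → :- ((n :* v) :* (:- (u :* q₂) :* x)) := (u :* v) :* (n :* (q₂ :* x)))
               refl n u (u ⁻¹) q₂ (q ⁻¹ * a ⁻¹)) ⟩
        - (n * a ⁻¹) * u ⁻¹ + (u * u ⁻¹) * (n * (q₂ * (q ⁻¹ * a ⁻¹)))
          ≈⟨ +-congˡ (trans (*-congʳ (⁻¹-inverseʳ u≉0)) (*-identityˡ _)) ⟩
        - (n * a ⁻¹) * u ⁻¹ + n * (q₂ * (q ⁻¹ * a ⁻¹)) ∎
        where
        u = z - w
        q = eval Q z
        q₂ = eval Q₂ z
        u≉0 : u ≉ 0#
        u≉0 = ≉⇒-≉0 z≉w
        inverse : (1# - z ^ suc k) * - (u ⁻¹ * q ⁻¹) ≈ 1#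
        inverse = begin
          (1# - z ^ suc k) * - (u ⁻¹ * q ⁻¹)  ≈⟨ *-congʳ (1-zⁿ z) ⟩
          - (u * q) * - (u ⁻¹ * q ⁻¹)         ≈⟨ solve 4 (λ u q v p → :- (u :* q) :* :- (v :* p) := (u :* v) :* (q :* p))
                                                  refl u q (u ⁻¹) (q ⁻¹) ⟩
          (u * u ⁻¹) * (q * q ⁻¹)             ≈⟨ *-cong (⁻¹-inverseʳ u≉0) (⁻¹-inverseʳ Qz≉0) ⟩
          1# * 1#                             ≈⟨ *-identityˡ 1# ⟩
          1#                                  ∎

    κ-pole : SimplePart (κ (suc k)) w (- ((w ⁻¹) ^ k))
    κ-pole = SimplePart-cong (λ _ → refl) (-‿cong residue) (record
      { regular             = λ z → n * (eval Q₂ z * (eval Q z ⁻¹ * a ⁻¹))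
      ; regular-cong        = λ e → *-congˡ (*-cong (eval-cong Q₂ e) (*-congʳ (⁻¹-cong (eval-cong Q e))))
      ; regular-holomorphic = Holomorphic-* (Holomorphic-const n) (Holomorphic-* (Holomorphic-eval Q₂)
          (Holomorphic-* (Holomorphic-⁻¹ (eval-cong Q) a≉0 (Holomorphic-eval Q)) (Holomorphic-const (a ⁻¹))))
      ; expansion           = Near-map (λ z Qz≉0 z≉w → expand z z≉w (Qz≉0 z≉w))
          (Lim-≉0 a≉0 (Differentiable⇒Lim (Near-centre (near (Holomorphic-eval Q)))))
      })
      where
      residue : n * a ⁻¹ ≈ (w ⁻¹) ^ k
      residue = begin
        n * a ⁻¹                   ≈⟨ *-congˡ a⁻¹≈ ⟨
        n * (n ⁻¹ * (w ⁻¹) ^ k)    ≈⟨ *-assoc n (n ⁻¹) _ ⟨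
        (n * n ⁻¹) * (w ⁻¹) ^ k    ≈⟨ *-congʳ (⁻¹-inverseʳ (·1≉0 k)) ⟩
        1# * (w ⁻¹) ^ k            ≈⟨ *-identityˡ _ ⟩
        (w ⁻¹) ^ k                 ∎

  𝟙[_] : ∀ {p} {P : Set p} → Dec P → Carrier
  𝟙[ P? ] = if does P? then 1# else 0#

  𝟙-cong : ∀ {a b} {A : Set a} {B : Set b} (A? : Dec A) (B? : Dec B) → (A → B) → (B → A) → 𝟙[ A? ] ≈ 𝟙[ B? ]
  𝟙-cong (yes _) (yes _) _ _ = refl
  𝟙-cong (no _)  (no _)  _ _ = refl
  𝟙-cong (yes a) (no ¬b) f _ = contradiction (f a) ¬b
  𝟙-cong (no ¬a) (yes b) _ g = contradiction (g b) ¬a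

  -- The indicator merges pole and regular point: away from the roots of unity the coefficient is 0
  -- and `κ` is its own regular part. Residues can then be added without case distinctions.
  κ-simplePart : ∀ k w → SimplePart (κ (suc k)) w (- 𝟙[ w ^ suc k ≟ 1# ] * (w ⁻¹) ^ k)
  κ-simplePart k w with w ^ suc k ≟ 1#
  ... | yes wⁿ≈1 = SimplePart-cong (λ _ → refl)
    (solve 1 (λ x → :- x := :- con (+ 1) :* x) refl ((w ⁻¹) ^ k)) (κ-pole k wⁿ≈1)
  ... | no wⁿ≉1  = SimplePart-cong (λ _ → refl)
    (solve 1 (λ x → con (+ 0) := :- con (+ 0) :* x) refl ((w ⁻¹) ^ k))
    (Holomorphic⇒SimplePart (κ-cong (suc k)) (κ-holomorphic (suc k) wⁿ≉1))

-- Geometric series and generating functions of power sums.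

module Series {c ℓ₁ ℓ₂} {ℝ : CompleteOrderedField c ℓ₁ ℓ₂} (K : NormedField ℝ) where
  open NormedField K
  open Limits K
  private module R = Reals ℝ
  open IntegerSolver commutativeRing
  open Relation.Binary.Reasoning.Setoid setoid
  open Algebra.Properties.Semiring.Sum semiring using (sum-cong-≋; *-distribˡ-sum; ∑-distrib-+; sum-replicate-zero)
  open Algebra.Properties.CommutativeSemiring.Exp commutativeSemiring using (^-distrib-*)

  partialSum : (ℕ → Carrier) → ℕ → Carrier
  partialSum a n = sum {n} (λ i → a (toℕ i))

  record HasSum (a : ℕ → Carrier) (s : Carrier) : Set (c ⊔ ℓ₂) where
    constructor hasSum
    field converges : ∀ ε → R.0# R.< ε → ∃[ N ] ∀ n → N ℕ.≤ n → ∣ partialSum a n - s ∣< ε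
  open HasSum public

  private variable
    a b : ℕ → Carrier
    s t : Carrier

  HasSum-cong : (∀ m → a m ≈ b m) → s ≈ t → HasSum a s → HasSum b t
  HasSum-cong a≈b s≈t (hasSum a→s) = hasSum λ ε 0<ε → let N , close = a→s ε 0<ε in
    N , λ n N≤n → ∣∣<-cong (+-cong (sum-cong-≋ {n} (λ i → a≈b (toℕ i))) (-‿cong s≈t)) R.refl (close n N≤n)

  partialSum-+ : ∀ a b n → partialSum (λ m → a m + b m) n ≈ partialSum a n + partialSum b n
  partialSum-+ a b n = ∑-distrib-+ {n} (λ i → a (toℕ i)) (λ i → b (toℕ i))

  HasSum-+ : HasSum a s → HasSum b t → HasSum (λ m → a m + b m) (s + t)
  HasSum-+ {a} {s} {b} {t} (hasSum a→s) (hasSum b→t) = hasSum λ ε 0<ε →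
    let h , 0<h , h+h≈ε = R.∃-half 0<ε
        M , a-close     = a→s h 0<h
        N , b-close     = b→t h 0<h
    in M ℕ.⊔ N , λ n M⊔N≤n → ∣∣<-cong (rearrange n) h+h≈ε
         (∣∣<-+ (a-close n (ℕ.m⊔n≤o⇒m≤o M N M⊔N≤n)) (b-close n (ℕ.m⊔n≤o⇒n≤o M N M⊔N≤n)))
    where
    rearrange : ∀ n → (partialSum a n - s) + (partialSum b n - t)
                      ≈ partialSum (λ m → a m + b m) n - (s + t)
    rearrange n = trans
      (solve 4 (λ x y s t → (x :- s) :+ (y :- t) := (x :+ y) :- (s :+ t)) refl
        (partialSum a n) (partialSum b n) s t)
      (+-congʳ (sym (partialSum-+ a b n)))

  HasSum-0 : HasSum (λ _ → 0#) 0#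
  HasSum-0 = hasSum λ ε 0<ε → 0 , λ n _ → ∣∣<-cong
    (sym (trans (+-congʳ (sum-replicate-zero n)) (-‿inverseʳ 0#))) R.refl (∣0∣< 0<ε)

  partialSum-geometric : ∀ x n → (1# - x) * partialSum (x ^_) n ≈ 1# - x ^ n
  partialSum-geometric x zero = solve 1 (λ x → (con (+ 1) :- x) :* con (+ 0) := con (+ 1) :- con (+ 1)) refl x
  partialSum-geometric x (suc n) = begin
    (1# - x) * (1# + sum (λ i → x * x ^ toℕ {n} i))  ≈⟨ *-congˡ (+-congˡ (*-distribˡ-sum {n} x (λ i → x ^ toℕ i))) ⟨
    (1# - x) * (1# + x * S)                      ≈⟨ solve 2 (λ x S → (con (+ 1) :- x) :* (con (+ 1) :+ x :* S)
                                                      := (con (+ 1) :- x) :+ x :* ((con (+ 1) :- x) :* S)) refl x S ⟩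
    (1# - x) + x * ((1# - x) * S)                ≈⟨ +-congˡ (*-congˡ (partialSum-geometric x n)) ⟩
    (1# - x) + x * (1# - x ^ n)                  ≈⟨ solve 2 (λ x X → (con (+ 1) :- x) :+ x :* (con (+ 1) :- X)
                                                      := con (+ 1) :- x :* X) refl x (x ^ n) ⟩
    1# - x * x ^ n                               ∎
    where S = partialSum (x ^_) n

  -- The error after n terms is -v x^n with v = 1/(1 - x). If |v| < M, it suffices that |x^n| < ε/M.
  geometric-sum : ∀ {x} → ∣ x ∣< R.1# → 1# - x ≉ 0# → HasSum (x ^_) ((1# - x) ⁻¹)
  geometric-sum {x} x<1 1-x≉0 = hasSum λ ε 0<ε →
    let M , v<M       = ∃-∣∣< v
        δ , 0<δ , Mδ≈ε = R.∃-quotient 0<ε (∣∣<⇒0< v<M)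
        N , small     = ^-vanishes x<1 δ 0<δ
    in N , λ n N≤n → ∣∣<-cong (sym (remainder n)) Mδ≈ε (∣∣<-* v<M (∣∣<-neg (small n N≤n)))
    where
    v = (1# - x) ⁻¹
    remainder : ∀ n → partialSum (x ^_) n - v ≈ v * - (x ^ n)
    remainder n = *-cancelˡ 1-x≉0 (begin
      (1# - x) * (S - v)               ≈⟨ solve 3 (λ u S v → u :* (S :- v) := u :* S :- u :* v) refl (1# - x) S v ⟩
      (1# - x) * S - (1# - x) * v      ≈⟨ +-cong (partialSum-geometric x n) (-‿cong (⁻¹-inverseʳ 1-x≉0)) ⟩
      1# - x ^ n - 1#                  ≈⟨ solve 1 (λ X → con (+ 1) :- X :- con (+ 1) := con (+ 1) :* :- X) refl (x ^ n) ⟩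
      1# * - (x ^ n)                   ≈⟨ *-congʳ (⁻¹-inverseʳ 1-x≉0) ⟨
      (1# - x) * v * - (x ^ n)         ≈⟨ *-assoc _ _ _ ⟩
      (1# - x) * (v * - (x ^ n))       ∎)
      where S = partialSum (x ^_) n

  ∣∣<1⇒1-z≉0 : ∀ {z} → ∣ z ∣< R.1# → 1# - z ≉ 0#
  ∣∣<1⇒1-z≉0 z<1 1-z≈0 = ∣1∣≮1 (∣∣<-cong (sym (x-y≈0⇒x≈y 1-z≈0)) R.refl z<1)

  -- By induction on the number of zeros, each contributing one geometric series in αᵢz; being
  -- finite, the sum over i passes through the limit.
  powerSums-sum : ∀ {d} (α : Vector Carrier d) z → (∀ i → ∣ α i * z ∣< R.1#) →
    HasSum (λ m → sum (λ i → α i ^ m) * z ^ m) (sum (λ i → (1# - α i * z) ⁻¹))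
  powerSums-sum {zero}  α z _ = HasSum-cong (λ m → sym (zeroˡ _)) refl HasSum-0
  powerSums-sum {suc d} α z αz<1 = HasSum-cong
    (λ m → trans (+-congʳ (^-distrib-* (α Fin.zero) z m)) (sym (distribʳ (z ^ m) _ _))) refl
    (HasSum-+ (geometric-sum (αz<1 Fin.zero) (∣∣<1⇒1-z≉0 (αz<1 Fin.zero)))
              (powerSums-sum (α ∘ Fin.suc) z (αz<1 ∘ Fin.suc)))

-- Logarithmic derivatives.

module LogarithmicDerivative {c ℓ₁ ℓ₂} {ℝ : CompleteOrderedField c ℓ₁ ℓ₂} (K : NormedField ℝ) where
  open NormedField K
  open Limits K
  open Holomorphy K
  open Series K
  private module R = Reals ℝ
  open Algebra.Properties.Semiring.Sum semiring using (sum-cong-≋; *-distribˡ-sum)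
  open Algebra.Properties.Semiring.Exp semiring using (^-congˡ)
  open Algebra.Properties.CommutativeSemiring.Exp commutativeSemiring using (^-distrib-*)
  open IntegerSolver commutativeRing
  open Relation.Binary.Reasoning.Setoid setoid

  private variable
    f g : Carrier → Carrier
    w ℓ m : Carrier

  -- The logarithmic derivative, as the factor ℓ in f′ = f ℓ.
  LogDeriv : (Carrier → Carrier) → Carrier → Carrier → Set (c ⊔ ℓ₁ ⊔ ℓ₂)
  LogDeriv f w ℓ = Deriv f w (f w * ℓ)

  LogDeriv-cong : ℓ ≈ m → LogDeriv f w ℓ → LogDeriv f w m
  LogDeriv-cong ℓ≈m = Deriv-≗ (λ _ → refl) (*-congˡ ℓ≈m)

  LogDeriv-unique : (∀ z → f z ≈ g z) → f w ≉ 0# → LogDeriv f w ℓ → LogDeriv g w m → ℓ ≈ m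
  LogDeriv-unique f≈g fw≉0 df dg = *-cancelˡ fw≉0
    (Deriv-unique df (Deriv-≗ (λ z → sym (f≈g z)) (*-congʳ (sym (f≈g _))) dg))

  LogDeriv-const : ∀ x → LogDeriv (λ _ → x) w 0#
  LogDeriv-const x = Deriv-≗ (λ _ → refl) (sym (zeroʳ x)) (Deriv-const x)

  LogDeriv-* : LogDeriv f w ℓ → LogDeriv g w m → LogDeriv (λ z → f z * g z) w (ℓ + m)
  LogDeriv-* {f} {w} {ℓ} {g} {m} df dg = Deriv-≗ (λ _ → refl)
    (solve 4 (λ f g ℓ m → f :* ℓ :* g :+ f :* (g :* m) := f :* g :* (ℓ :+ m)) refl (f w) (g w) ℓ m)
    (Deriv-* df dg)

  LogDeriv-linear : ∀ x → w - x ≉ 0# → LogDeriv (λ t → t - x) w ((w - x) ⁻¹)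
  LogDeriv-linear x w-x≉0 = Deriv-≗ (λ _ → refl)
    (trans (solve 0 (con (+ 1) :+ :- con (+ 0) := con (+ 1)) refl) (sym (⁻¹-inverseʳ w-x≉0)))
    (Deriv-+ Deriv-id (Deriv-neg (Deriv-const x)))

  LogDeriv-product : ∀ {d} (α : Vector Carrier d) → (∀ i → w - α i ≉ 0#) →
    LogDeriv (λ t → product (λ i → t - α i)) w (sum (λ i → (w - α i) ⁻¹))
  LogDeriv-product {d = zero}  α _     = LogDeriv-const 1#
  LogDeriv-product {d = suc d} α w-α≉0 = LogDeriv-*
    (LogDeriv-linear (α Fin.zero) (w-α≉0 Fin.zero))
    (LogDeriv-product (α ∘ Fin.suc) (w-α≉0 ∘ Fin.suc))

  LogDeriv-^ : ∀ n → w ≉ 0# → LogDeriv (_^ n) w (n · 1# * w ⁻¹)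
  LogDeriv-^ zero w≉0 = LogDeriv-cong (sym (zeroˡ _)) (LogDeriv-const 1#)
  LogDeriv-^ {w} (suc n) w≉0 = LogDeriv-cong
    (solve 2 (λ u N → u :+ N :* u := (con (+ 1) :+ N) :* u) refl (w ⁻¹) (n · 1#))
    (LogDeriv-* (Deriv-≗ (λ _ → refl) (sym (⁻¹-inverseʳ w≉0)) Deriv-id) (LogDeriv-^ n w≉0))

  product-≈0 : ∀ {d} (β : Vector Carrier d) i → β i ≈ 0# → product β ≈ 0#
  product-≈0 β Fin.zero    βᵢ≈0 = trans (*-congʳ βᵢ≈0) (zeroˡ _)
  product-≈0 β (Fin.suc i) βᵢ≈0 = trans (*-congˡ (product-≈0 (β ∘ Fin.suc) i βᵢ≈0)) (zeroʳ _)

  ∣∣<1-^ : ∀ {z} n → ∣ z ∣< R.1# → ∣ z ^ suc n ∣< R.1#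
  ∣∣<1-^ zero    z<1 = ∣∣<-cong (sym (*-identityʳ _)) R.refl z<1
  ∣∣<1-^ (suc n) z<1 = ∣∣<-cong refl (R.*-identityʳ R.1#) (∣∣<-* z<1 (∣∣<1-^ n z<1))

  module _ {z w : Carrier} (wz≈1 : w * z ≈ 1#) where

    [w-x]z≈1-xz : ∀ x → (w - x) * z ≈ 1# - x * z
    [w-x]z≈1-xz x = trans
      (solve 3 (λ w x z → (w :- x) :* z := w :* z :- x :* z) refl w x z) (+-congʳ wz≈1)

    -- With w = 1/z, this carries a logarithmic derivative in t at w over to the geometric sums in
    -- z, at the price of one factor z.
    [w-x]⁻¹≈ : ∀ x → 1# - x * z ≉ 0# → (w - x) ⁻¹ ≈ z * (1# - x * z) ⁻¹
    [w-x]⁻¹≈ x 1-xz≉0 = sym (⁻¹-unique (begin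
      (w - x) * (z * (1# - x * z) ⁻¹)    ≈⟨ *-assoc _ z _ ⟨
      (w - x) * z * (1# - x * z) ⁻¹      ≈⟨ *-congʳ ([w-x]z≈1-xz x) ⟩
      (1# - x * z) * (1# - x * z) ⁻¹     ≈⟨ ⁻¹-inverseʳ 1-xz≉0 ⟩
      1#                                 ∎))

    -- Here WZ = 1. The derivative nW/w equals nzW, and inserting (1 - Z)/(1 - Z) produces the
    -- factor W - WZ = W - 1.
    LogDeriv-^-1 : ∀ n → 1# - z ^ n ≉ 0# → LogDeriv (λ t → t ^ n - 1#) w (z * κ n z)
    LogDeriv-^-1 n 1-zⁿ≉0 = Deriv-≗ (λ _ → refl) eq
      (Deriv-+ (LogDeriv-^ n w≉0) (Deriv-neg (Deriv-const 1#)))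
      where
      w≉0 : w ≉ 0#
      w≉0 = *-≉0ˡ (≉-resp wz≈1 1≉0)
      W = w ^ n
      Z = z ^ n
      N = n · 1#
      eq : W * (N * w ⁻¹) + - 0# ≈ (W - 1#) * (z * (N * (1# - Z) ⁻¹))
      eq = begin
        W * (N * w ⁻¹) + - 0#
          ≈⟨ solve 3 (λ W N v → W :* (N :* v) :+ :- con (+ 0) := N :* v :* (W :* con (+ 1))) refl W N (w ⁻¹) ⟩
        N * w ⁻¹ * (W * 1#)
          ≈⟨ *-cong (*-congˡ (⁻¹-unique wz≈1)) (*-congˡ (⁻¹-inverseʳ 1-zⁿ≉0)) ⟨
        N * z * (W * ((1# - Z) * (1# - Z) ⁻¹))
          ≈⟨ solve 5 (λ N z W Z v → N :* z :* (W :* ((con (+ 1) :- Z) :* v))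
                := (W :- W :* Z) :* (z :* (N :* v))) refl N z W Z ((1# - Z) ⁻¹) ⟩
        (W - W * Z) * (z * (N * (1# - Z) ⁻¹))
          ≈⟨ *-congʳ (+-congˡ (-‿cong (^-inverse n wz≈1))) ⟩
        (W - 1#) * (z * (N * (1# - Z) ⁻¹)) ∎

  -- The closed form and its agreement with the moment series.

  module _ (p′ q′ : ℕ) where
    private
      p = suc p′
      q = suc q′
      -- `p ℕ.* q` computes to `suc pq′`, so lemmas about successor exponents apply to it directly.
      pq′ = q′ ℕ.+ p′ ℕ.* q

    -- The last term is kept in the form required by the theorem; the local `κ₁≈` identifies it with
    -- `κ 1` when residues are computed.
    closedForm : Carrier → Carrier
    closedForm z = κ (p ℕ.* q) z - κ p z - κ q z + 1# / (1# - z)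

    closedForm-cong : Congruent closedForm
    closedForm-cong e = +-cong
      (+-cong (+-cong (κ-cong (p ℕ.* q) e) (-‿cong (κ-cong p e))) (-‿cong (κ-cong q e)))
      (*-congˡ (⁻¹-cong (+-congˡ (-‿cong e))))

    closedForm-holomorphic : ∀ {w} → w ^ (p ℕ.* q) ≉ 1# → w ^ p ≉ 1# → w ^ q ≉ 1# → w ≉ 1# →
      Holomorphic closedForm w
    closedForm-holomorphic wᵖᑫ≉1 wᵖ≉1 wᑫ≉1 w≉1 = Holomorphic-+
      (Holomorphic-+ (Holomorphic-+ (κ-holomorphic (p ℕ.* q) wᵖᑫ≉1) (Holomorphic-neg (κ-holomorphic p wᵖ≉1)))
        (Holomorphic-neg (κ-holomorphic q wᑫ≉1)))
      (Holomorphic-* (Holomorphic-const 1#) (Holomorphic-⁻¹ (λ e → +-congˡ (-‿cong e)) (≉⇒-≉0 (w≉1 ∘ sym))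
        (Holomorphic-+ (Holomorphic-const 1#) (Holomorphic-neg Holomorphic-id))))

    -- Linearity applied to the four terms. The term with exponent 1 yields the test w^1 = 1 and the
    -- factor (1/w)^0, which are simplified to w = 1 and 1.
    closedForm-simplePart : ∀ w → SimplePart closedForm w
      (- 𝟙[ w ^ (p ℕ.* q) ≟ 1# ] * (w ⁻¹) ^ (p ℕ.* q ℕ.∸ 1)
        + 𝟙[ w ^ p ≟ 1# ] * (w ⁻¹) ^ (p ℕ.∸ 1)
        + 𝟙[ w ^ q ≟ 1# ] * (w ⁻¹) ^ (q ℕ.∸ 1)
        - 𝟙[ w ≟ 1# ])
    closedForm-simplePart w = SimplePart-cong κ₁≈
      (trans (+-congˡ (trans
          (solve 1 (λ x → :- x :* con (+ 1) := :- x) refl 𝟙[ w ^ 1 ≟ 1# ])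
          (-‿cong (𝟙-cong (w ^ 1 ≟ 1#) (w ≟ 1#) (trans (sym (*-identityʳ w))) (trans (*-identityʳ w))))))
        (solve 6 (λ x s y t z v → x :+ :- (:- s :* y) :+ :- (:- t :* z) :+ v
            := x :+ s :* y :+ t :* z :+ v) refl _ _ _ _ _ _))
      (SimplePart-+ (SimplePart-+ (SimplePart-+ (κ-simplePart pq′ w) (SimplePart-neg (κ-simplePart p′ w)))
        (SimplePart-neg (κ-simplePart q′ w))) (κ-simplePart 0 w))
      where
      κ₁≈ : ∀ z → κ (p ℕ.* q) z - κ p z - κ q z + κ 1 z ≈ closedForm z
      κ₁≈ z = +-congˡ (*-cong (+-identityʳ 1#) (⁻¹-cong (+-congˡ (-‿cong (*-identityʳ z)))))

    module _ {d} (a : Carrier) (α : Vector Carrier d) (a≉0 : a ≉ 0#)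
      (factorisation : ∀ t → a * product (λ i → t - α i) * ((t ^ p - 1#) * (t ^ q - 1#))
                           ≈ (t ^ (p ℕ.* q) - 1#) * (t - 1#)) where

      -- At t = αᵢ the left side of the identity vanishes, so αᵢ^(pq) = 1 or αᵢ = 1, and the second
      -- implies the first.
      α^pq≈1 : ∀ i → α i ^ (p ℕ.* q) ≈ 1#
      α^pq≈1 i with α i ^ (p ℕ.* q) ≟ 1#
      ... | yes e  = e
      ... | no  ≉1 = trans (^-congˡ (p ℕ.* q) α≈1) (1^n≈1 (p ℕ.* q))
        where
        α≈1 : α i ≈ 1#
        α≈1 = x-y≈0⇒x≈y (*-cancelˡ (≉⇒-≉0 ≉1) (begin
          (α i ^ (p ℕ.* q) - 1#) * (α i - 1#)
            ≈⟨ factorisation (α i) ⟨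
          a * product (λ j → α i - α j) * ((α i ^ p - 1#) * (α i ^ q - 1#))
            ≈⟨ *-congʳ (*-congˡ (product-≈0 (λ j → α i - α j) i (-‿inverseʳ (α i)))) ⟩
          a * 0# * ((α i ^ p - 1#) * (α i ^ q - 1#))
            ≈⟨ solve 3 (λ a x y → a :* con (+ 0) :* x := y :* con (+ 0)) refl a _ _ ⟩
          (α i ^ (p ℕ.* q) - 1#) * 0# ∎))

      ∣αz∣<1 : ∀ {z} → ∣ z ∣< R.1# → ∀ i → ∣ α i * z ∣< R.1#
      ∣αz∣<1 {z} z<1 i = ∣^∣<1⇒∣∣<1 (p ℕ.* q) (∣∣<-cong (begin
        z ^ (p ℕ.* q)                      ≈⟨ *-identityˡ _ ⟨
        1# * z ^ (p ℕ.* q)                 ≈⟨ *-congʳ (α^pq≈1 i) ⟨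
        α i ^ (p ℕ.* q) * z ^ (p ℕ.* q)    ≈⟨ ^-distrib-* (α i) z (p ℕ.* q) ⟨
        (α i * z) ^ (p ℕ.* q)              ∎) R.refl (∣∣<1-^ pq′ z<1))

      poles : Carrier → Carrier
      poles z = sum (λ i → (1# - α i * z) ⁻¹)

      poles-cong : Congruent poles
      poles-cong {x} {y} e = sum-cong-≋ {d} {λ i → (1# - α i * x) ⁻¹} {λ i → (1# - α i * y) ⁻¹}
        (λ i → ⁻¹-cong (+-congˡ (-‿cong (*-congˡ e))))

      private
        poles≈closedForm-≉0 : ∀ {z} → ∣ z ∣< R.1# → z ≉ 0# → poles z ≈ closedForm z
        poles≈closedForm-≉0 {z} z<1 z≉0 = begin
          poles z
            -- The terms are arranged as the logarithmic derivative of the left side delivers them;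
            -- `0#` is the share of the constant a.
            ≈⟨ solve 3 (λ S P Q → S := con (+ 0) :+ S :+ (P :+ Q) :- P :- Q) refl (poles z) (κ p z) (κ q z) ⟩
          0# + poles z + (κ p z + κ q z) - κ p z - κ q z
            ≈⟨ +-congʳ (+-congʳ (*-cancelˡ z≉0 z*)) ⟩
          κ (p ℕ.* q) z + (1# - z) ⁻¹ - κ p z - κ q z
            ≈⟨ solve 4 (λ R O P Q → R :+ O :- P :- Q := R :- P :- Q :+ con (+ 1) :* O) refl
                 (κ (p ℕ.* q) z) ((1# - z) ⁻¹) (κ p z) (κ q z) ⟩
          closedForm z ∎
          where
          w′ = z ⁻¹
          wz≈1 : w′ * z ≈ 1#
          wz≈1 = trans (*-comm w′ z) (⁻¹-inverseʳ z≉0)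
          1-zⁿ≉0 : ∀ n → 1# - z ^ suc n ≉ 0#
          1-zⁿ≉0 n = ∣∣<1⇒1-z≉0 (∣∣<1-^ n z<1)
          wⁿ-1≉0 : ∀ n → w′ ^ suc n - 1# ≉ 0#
          wⁿ-1≉0 n e = 1-zⁿ≉0 n (x≈y⇒x-y≈0 (begin
            1#                       ≈⟨ ^-inverse (suc n) wz≈1 ⟨
            w′ ^ suc n * z ^ suc n   ≈⟨ *-congʳ (x-y≈0⇒x≈y e) ⟩
            1# * z ^ suc n           ≈⟨ *-identityˡ _ ⟩
            z ^ suc n                ∎))
          w-1≉0 : w′ - 1# ≉ 0#
          w-1≉0 = ≉-resp (+-congʳ (sym (*-identityʳ w′))) (wⁿ-1≉0 0)
          -- Since |z| < 1, neither z^(pq) nor z is 1, hence neither is its inverse. Through the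
          -- identity this makes every factor on the left nonzero.
          right≉0 : (w′ ^ (p ℕ.* q) - 1#) * (w′ - 1#) ≉ 0#
          right≉0 = *-≉0 (wⁿ-1≉0 pq′) w-1≉0
          left≉0 : a * product (λ i → w′ - α i) * ((w′ ^ p - 1#) * (w′ ^ q - 1#)) ≉ 0#
          left≉0 = ≉-resp (factorisation w′) right≉0
          w-α≉0 : ∀ i → w′ - α i ≉ 0#
          w-α≉0 i e = *-≉0ʳ (*-≉0ˡ left≉0) (product-≈0 (λ i → w′ - α i) i e)
          z≈1*z = *-identityˡ z
          sum≈ : sum (λ i → (w′ - α i) ⁻¹) ≈ z * poles z
          sum≈ = trans
            (sum-cong-≋ {d} {λ i → (w′ - α i) ⁻¹} {λ i → z * (1# - α i * z) ⁻¹}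
              (λ i → [w-x]⁻¹≈ wz≈1 (α i) (∣∣<1⇒1-z≉0 (∣αz∣<1 z<1 i))))
            (sym (*-distribˡ-sum {d} z (λ i → (1# - α i * z) ⁻¹)))
          [w-1]⁻¹≈ : (w′ - 1#) ⁻¹ ≈ z * (1# - z) ⁻¹
          [w-1]⁻¹≈ = trans ([w-x]⁻¹≈ wz≈1 1# (≉-resp (+-congˡ (-‿cong z≈1*z)) (∣∣<1⇒1-z≉0 z<1)))
                           (*-congˡ (⁻¹-cong (+-congˡ (-‿cong z≈1*z))))
          z* : z * (0# + poles z + (κ p z + κ q z)) ≈ z * (κ (p ℕ.* q) z + (1# - z) ⁻¹)
          z* = begin
            z * (0# + poles z + (κ p z + κ q z))
              ≈⟨ solve 4 (λ z S P Q → z :* (con (+ 0) :+ S :+ (P :+ Q)) := con (+ 0) :+ z :* S :+ (z :* P :+ z :* Q))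
                   refl z (poles z) (κ p z) (κ q z) ⟩
            0# + z * poles z + (z * κ p z + z * κ q z)
              ≈⟨ LogDeriv-unique factorisation left≉0
                   (LogDeriv-* (LogDeriv-* (LogDeriv-const a) (LogDeriv-cong sum≈ (LogDeriv-product α w-α≉0)))
                     (LogDeriv-* (LogDeriv-^-1 wz≈1 p (1-zⁿ≉0 p′)) (LogDeriv-^-1 wz≈1 q (1-zⁿ≉0 q′))))
                   (LogDeriv-* (LogDeriv-^-1 wz≈1 (p ℕ.* q) (1-zⁿ≉0 pq′))
                     (LogDeriv-cong [w-1]⁻¹≈ (LogDeriv-linear 1# w-1≉0))) ⟩
            z * κ (p ℕ.* q) z + z * (1# - z) ⁻¹
              ≈⟨ distribˡ z _ _ ⟨
            z * (κ (p ℕ.* q) z + (1# - z) ⁻¹) ∎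

        0ⁿ≉1 : ∀ n → 0# ^ suc n ≉ 1#
        0ⁿ≉1 n 0≈1 = 1≉0 (trans (sym 0≈1) (zeroˡ _))

        -- Stated for an arbitrary vector so that the induction can drop its head.
        Lim-poles-0 : ∀ {d} (β : Vector Carrier d) →
          Lim (λ z → sum (λ i → (1# - β i * z) ⁻¹)) 0# (sum (λ i → (1# - β i * 0#) ⁻¹))
        Lim-poles-0 {zero}  β = Lim-const 0#
        Lim-poles-0 {suc d} β = Lim-+
          (Lim-⁻¹ (≉-resp (solve 1 (λ b → con (+ 1) :- b :* con (+ 0) := con (+ 1)) refl (β Fin.zero)) 1≉0)
            (Lim-+ (Lim-const 1#) (Lim-neg (Lim-* (Lim-const (β Fin.zero)) Lim-id))))
          (Lim-poles-0 (β ∘ Fin.suc))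

        poles≈closedForm-0 : poles 0# ≈ closedForm 0#
        poles≈closedForm-0 = Lim-unique
          (Lim-cong
            (R.1# , R.0<1 , λ z z<1 z≉0 → poles≈closedForm-≉0
              (∣∣<-cong (solve 1 (λ z → z :- con (+ 0) := z) refl z) R.refl z<1) z≉0)
            refl (Lim-poles-0 α))
          (Differentiable⇒Lim (Near-centre (near
            (closedForm-holomorphic (0ⁿ≉1 pq′) (0ⁿ≉1 p′) (0ⁿ≉1 q′) (1≉0 ∘ sym)))))

      poles≈closedForm : ∀ {z} → ∣ z ∣< R.1# → poles z ≈ closedForm z
      poles≈closedForm {z} z<1 with z ≟ 0#
      ... | no  z≉0 = poles≈closedForm-≉0 z<1 z≉0
      ... | yes z≈0 = trans (poles-cong z≈0) (trans poles≈closedForm-0 (closedForm-cong (sym z≈0)))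

      moments-sum : ∀ z → ∣ z ∣< R.1# → HasSum (λ m → sum (λ i → α i ^ m) * z ^ m) (closedForm z)
      moments-sum z z<1 = HasSum-cong (λ _ → refl) (poles≈closedForm z<1) (powerSums-sum α z (∣αz∣<1 z<1))

-- ℂ as a normed field.

module ComplexNorm {c ℓ₁ ℓ₂} (ℝ : CompleteOrderedField c ℓ₁ ℓ₂) where
  open Complex ℝ
  open ComplexField ℝ
  private module R where
    open Reals ℝ public
    open Algebra.Properties.Semiring.Exp semiring public using (_^_)

  normSq-^ : ∀ z n → normSq (z ^ n) R.≈ normSq z R.^ n
  normSq-^ z zero    = normSq-1
  normSq-^ z (suc n) = R.trans (normSq-* z (z ^ n)) (R.*-congˡ (normSq-^ z n))

  -- Characteristic 0 is inherited from the order of the reals through the real part.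
  re-ofℕ-nonneg : ∀ n → R.0# R.≤ re (ofℕ n)
  re-ofℕ-nonneg zero    = inj₂ R.refl
  re-ofℕ-nonneg (suc n) = inj₁ (R.+-pos-nonneg R.0<1 (re-ofℕ-nonneg n))

  ofℕ≉0 : ∀ n → ofℕ (suc n) ≉ 0#
  ofℕ≉0 n (e , _) = R.pos⇒≉0 (R.+-pos-nonneg R.0<1 (re-ofℕ-nonneg n)) e

  ∣∣<1⇒normSq<1 : ∀ {z} → ∣ z ∣<1 → normSq z R.< R.1#
  ∣∣<1⇒normSq<1 (_ , p) = R.<-respʳ (R.*-identityʳ R.1#) p

  normSq<1⇒∣∣<1 : ∀ {z} → normSq z R.< R.1# → ∣ z ∣<1
  normSq<1⇒∣∣<1 p = R.0<1 , R.<-respʳ (R.sym (R.*-identityʳ R.1#)) p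

  ^-vanishes : ∀ {z} → ∣ z ∣<1 → ∀ ε → R.0# R.< ε → ∃[ N ] ∀ n → N ℕ.≤ n → ∣ z ^ n ∣< ε
  ^-vanishes {z} z<1 ε 0<ε
    with R.^-vanishes (normSq-nonneg z) (∣∣<1⇒normSq<1 {z} z<1) (R.*-pos 0<ε 0<ε)
  ... | N , small = N , λ n N≤n → 0<ε , R.<-respˡ (R.sym (normSq-^ z n)) (small n N≤n)

  -- Otherwise |z|² ≥ 1, and all powers of |z|² would be at least 1.
  ∣^∣<1⇒∣∣<1 : ∀ {z} n → ∣ z ^ n ∣<1 → ∣ z ∣<1
  ∣^∣<1⇒∣∣<1 {z} n zⁿ<1 with R.≤-<-connex R.1# (normSq z)
  ... | inj₂ p = normSq<1⇒∣∣<1 {z} p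
  ... | inj₁ p = contradiction
    (R.<-respˡ (normSq-^ z n) (∣∣<1⇒normSq<1 {z ^ n} zⁿ<1)) (R.≤⇒≯ (R.1≤^ p n))

  ∣1∣≮1 : ¬ ∣ 1# ∣<1
  ∣1∣≮1 1<1 = R.<-irrefl normSq-1 (∣∣<1⇒normSq<1 {1#} 1<1)

  ℂ-normedField : NormedField ℝ
  ℂ-normedField = record
    { commutativeRing = ℂ-commutativeRing
    ; _≟_             = _≟_
    ; _⁻¹             = _⁻¹
    ; ⁻¹-cong         = ⁻¹-cong
    ; ⁻¹-inverseʳ     = ⁻¹-inverseʳ
    ; ·1≉0            = ofℕ≉0
    ; ∣_∣<_           = ∣_∣<_
    ; ∣∣<⇒0<          = proj₁
    ; ∣∣<-cong        = ∣∣<-cong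
    ; ∣∣<-weaken      = λ {z} → ∣∣<-weaken {z}
    ; ∣0∣<            = ∣0∣<
    ; ∣1∣≮1           = ∣1∣≮1
    ; ∣∣<-neg         = λ {z} → ∣∣<-neg {z}
    ; ∣∣<-+           = λ {z} {w} → ∣∣<-+ {z} {w}
    ; ∣∣<-*           = λ {z} {w} → ∣∣<-* {z} {w}
    ; ∃-∣∣<           = ∃-∣∣<
    ; ∃-≮∣∣           = ∃-≮∣∣
    ; ∃-nonzero-∣∣<   = ∃-nonzero-∣∣<
    ; ∣⁻¹∣<           = ∣⁻¹∣<
    ; ^-vanishes      = λ {z} → ^-vanishes {z}
    ; ∣^∣<1⇒∣∣<1      = λ {z} → ∣^∣<1⇒∣∣<1 {z}
    }

-- From simple parts to the notions of the theorem.

module PrincipalParts {c ℓ₁ ℓ₂} (ℝ : CompleteOrderedField c ℓ₁ ℓ₂) where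
  open Complex ℝ
  open ComplexNorm ℝ using (ℂ-normedField)
  private module K where
    open NormedField ℂ-normedField public
    open Limits ℂ-normedField public
    open Holomorphy ℂ-normedField public

  Holomorphic⇒HolomorphicAt : ∀ F {w} → K.Holomorphic (F ⟨$⟩_) w → HolomorphicAt F w
  Holomorphic⇒HolomorphicAt F (K.holomorphic (ρ , 0<ρ , diff)) =
    ρ , 0<ρ , λ z z-near → let f′ , K.deriv (K.lim limit) = diff z z-near in f′ , limit

  module _ (F : Function) {w b} (S : K.SimplePart (F ⟨$⟩_) w b) where
    private
      module S = K.SimplePart S
      h : Function
      h = record { to = S.regular ; cong = S.regular-cong }

    SimplePart⇒HasPrincipalPart : HasPrincipalPart F w 1 (λ _ → b)
    SimplePart⇒HasPrincipalPart = h , Holomorphic⇒HolomorphicAt h S.regular-holomorphic ,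
      K.Near-map (λ z e z≉w → K.trans (e z≉w) (K.+-congʳ (K./≈/^1+0 b (z - w)))) S.expansion

    -- Handles points where the contributions cancel: the regular part alone then represents the
    -- function near w.
    SimplePart⇒removable : b ≈ 0# → HasPrincipalPart F w 0 (λ ())
    SimplePart⇒removable b≈0 = h , Holomorphic⇒HolomorphicAt h S.regular-holomorphic ,
      K.Near-map (λ z e z≉w → K.trans (e z≉w) (K.+-congʳ (K.trans (K.*-congʳ b≈0) (K.zeroˡ _)))) S.expansion

theorem5 : ∀ {c ℓ₁ ℓ₂} (ℝ : CompleteOrderedField c ℓ₁ ℓ₂) → let open Complex ℝ in
    (p q : ℕ) .{{_ : NonZero p}} .{{_ : NonZero q}} → Coprime p q →
    (Δ : Polynomial) → IsAlexanderPolynomial p q Δ →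
    (d : ℕ) (α : Vector ℂ d) → IsZeroListing Δ α →
    (∀ z → ∣ z ∣<1 →
    HasSum (λ m → moment α m * z ^ m)
    (ofℕ (p ℕ.* q) / (1# - z ^ (p ℕ.* q)) - ofℕ p / (1# - z ^ p)
    - ofℕ q / (1# - z ^ q) + 1# / (1# - z)))
    × (Σ Function λ G →
    (∀ z → ∣ z ∣<1 → HasSum (λ m → moment α m * z ^ m) (G ⟨$⟩ z))
    × (∀ w → MeromorphicAt G w)
    × (∀ w → ¬ IsRootOfUnity p q w → HolomorphicAt G w)
    × (∀ w → SingularAt G w → IsRootOfUnity p q w × HasSimplePole G w)
    × (∀ ξ → IsRootOfUnity p q ξ →
    HasResidue G ξ
    (- 𝟙[ ξ ^ (p ℕ.* q) ≟ 1# ] * (ξ ⁻¹) ^ (p ℕ.* q ∸ 1)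
    + 𝟙[ ξ ^ p ≟ 1# ] * (ξ ⁻¹) ^ (p ∸ 1)
    + 𝟙[ ξ ^ q ≟ 1# ] * (ξ ⁻¹) ^ (q ∸ 1)
    - 𝟙[ ξ ≟ 1# ])))
theorem5 ℝ (suc p′) (suc q′) _ Δ Δ-alexander d α (a , a≉0 , factorisation) =
  hasSum , G , hasSum , meromorphic , holomorphicAt , singular , residue
  where
  open Complex ℝ
  open ComplexNorm ℝ using (ℂ-normedField)
  open PrincipalParts ℝ
  module K where
    open NormedField ℂ-normedField public
    open Limits ℂ-normedField public
    open Holomorphy ℂ-normedField public
    open Series ℂ-normedField public
    open LogarithmicDerivative ℂ-normedField public
  p q : ℕ
  p = suc p′
  q = suc q′

  hasSum : ∀ z → ∣ z ∣<1 → HasSum (λ m → moment α m * z ^ m)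
    (ofℕ (p ℕ.* q) / (1# - z ^ (p ℕ.* q)) - ofℕ p / (1# - z ^ p)
      - ofℕ q / (1# - z ^ q) + 1# / (1# - z))
  -- The zero listing replaces `eval Δ t` in the Alexander identity, which leaves an identity in a
  -- and α alone.
  hasSum z z<1 = K.converges (K.moments-sum p′ q′ a α a≉0 (λ t →
    K.trans (K.*-congʳ (K.sym (factorisation t))) (Δ-alexander t)) z z<1)

  -- A total function: where a denominator is 0 its value is whatever `_⁻¹` gives there, and
  -- principal parts disregard the value at their centre.
  G : Function
  G = record { to = K.closedForm p′ q′ ; cong = K.closedForm-cong p′ q′ }

  coefficient : ℂ → ℂ
  coefficient ξ =
    - 𝟙[ ξ ^ (p ℕ.* q) ≟ 1# ] * (ξ ⁻¹) ^ (p ℕ.* q ∸ 1)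
      + 𝟙[ ξ ^ p ≟ 1# ] * (ξ ⁻¹) ^ (p ∸ 1)
      + 𝟙[ ξ ^ q ≟ 1# ] * (ξ ⁻¹) ^ (q ∸ 1)
      - 𝟙[ ξ ≟ 1# ]

  simplePart : ∀ w → K.SimplePart (G ⟨$⟩_) w (coefficient w)
  simplePart = K.closedForm-simplePart p′ q′

  principalPart : ∀ w → HasPrincipalPart G w 1 (λ _ → coefficient w)
  principalPart w = SimplePart⇒HasPrincipalPart G (simplePart w)

  meromorphic : ∀ w → MeromorphicAt G w
  meromorphic w = 1 , (λ _ → coefficient w) , principalPart w

  holomorphicAt : ∀ w → ¬ IsRootOfUnity p q w → HolomorphicAt G w
  holomorphicAt w w∉ = Holomorphic⇒HolomorphicAt G (K.closedForm-holomorphic p′ q′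
    (w∉ ∘ there ∘ there ∘ there ∘ here) (w∉ ∘ there ∘ here) (w∉ ∘ there ∘ there ∘ here)
    (λ w≈1 → w∉ (here (K.trans (K.*-identityʳ w) w≈1))))

  singular : ∀ w → SingularAt G w → IsRootOfUnity p q w × HasSimplePole G w
  singular w sing with any? (λ r → w ^ r ≟ 1#) (1 ∷ p ∷ q ∷ p ℕ.* q ∷ [])
  ... | no  w∉ = contradiction
    -- `G` is its own regular part, the empty principal part contributing `0#`.
    (G , holomorphicAt w w∉ , K.Near-all (λ z _ → K.sym (K.+-identityˡ (G ⟨$⟩ z)))) sing
  ... | yes w∈ with coefficient w ≟ 0#
  ...   | yes b≈0 = contradiction (SimplePart⇒removable G (simplePart w) b≈0) sing
  ...   | no  b≉0 = w∈ , coefficient w , b≉0 , principalPart w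

  residue : ∀ ξ → IsRootOfUnity p q ξ → HasResidue G ξ (coefficient ξ)
  -- The length index 0 stands for a single coefficient; it may be 0, so cancelled poles are covered
  -- as well.
  residue ξ _ = 0 , (λ _ → coefficient ξ) , principalPart ξ , K.refl
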